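{- There is an absolute constant $c>0$ such that the following holds. Let $F:\mathbb{R}\to\mathbb{R}$ be a strictly convex function, and let $A,B,C$ be finite sets of real numbers with $|A|=|B|=|C|=k$. Then \[ \max\{|A+B|,\ |F(A)+C|\}\ge c\,k^{5/4}. \] In particular, $|A+F(A)|\ge c\,k^{5/4}$ for every finite $A\subset\mathbb{R}$ with $|A|=k$.
   Context: $F(A)=\{F(a):a\in A\}$; for finite $X,Y\subset\mathbb{R}$, $X+Y=\{x+y:x\in X,y\in Y\}$. -}

module Defs where

open import Data.Fin.Base using (Fin)
open import Data.Integer.Base as ℤ using (+_)
import Data.Integer.Properties as ℤ
open import Data.Nat.Base as ℕ using (ℕ; zero; suc)
import Data.Nat.Properties as ℕ
open import Data.Nat.Solver using (module +-*-Solver)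
open import Data.Product.Base using (Σ-syntax; ∃-syntax; _×_; _,_)
open import Data.Rational.Base as ℚ using (ℚ; 0ℚ; 1ℚ; ½; ∣_∣; mkℚ)
import Data.Rational.Properties as ℚ
import Data.Rational.Solver as ℚ-Solver
import Data.Rational.Unnormalised.Base as ℚᵘ
import Data.Rational.Unnormalised.Properties as ℚᵘ
open import Data.Sum.Base using (_⊎_; inj₁; inj₂)
open import Function.Bundles using (Func; _⇔_; _⟨$⟩_)
open import Function.Definitions using (Injective)
open import Level using (0ℓ)
open import Relation.Binary.Bundles using (Setoid)
open import Relation.Binary.PropositionalEquality
open import Relation.Nullary using (¬_; yes; no)
open import Relation.Unary using (Pred)

module ℚS = ℚ-Solver.+-*-Solver

halve : ∀ ε → ½ ℚ.* ε ℚ.+ ½ ℚ.* ε ≡ ε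
halve = solve 1 (λ e → con ½ :* e :+ con ½ :* e := e) refl
  where open ℚS

half-pos : ∀ {ε} → 0ℚ ℚ.< ε → 0ℚ ℚ.< ½ ℚ.* ε
half-pos {ε} 0<ε = subst (ℚ._< ½ ℚ.* ε) (ℚ.*-zeroʳ ½) (ℚ.*-monoʳ-<-pos ½ 0<ε)

neg-diff : ∀ p q → ℚ.- (p ℚ.- q) ≡ q ℚ.- p
neg-diff = solve 2 (λ p q → :- (p :- q) := q :- p) refl
  where open ℚS

-‿swap : ∀ p q → ∣ p ℚ.- q ∣ ≡ ∣ q ℚ.- p ∣
-‿swap p q = trans (sym (ℚ.∣-p∣≡∣p∣ (p ℚ.- q))) (cong ∣_∣ (neg-diff p q))

∣∣-triangle : ∀ p q {r} → p ℚ.+ q ≡ r → ∣ r ∣ ℚ.≤ ∣ p ∣ ℚ.+ ∣ q ∣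
∣∣-triangle p q refl = ℚ.∣p+q∣≤∣p∣+∣q∣ p q

-‿triangle : ∀ p q r → ∣ p ℚ.- r ∣ ℚ.≤ ∣ p ℚ.- q ∣ ℚ.+ ∣ q ℚ.- r ∣
-‿triangle p q r = ∣∣-triangle (p ℚ.- q) (q ℚ.- r) (lemma p q r)
  where
  open ℚS
  lemma : ∀ p q r → (p ℚ.- q) ℚ.+ (q ℚ.- r) ≡ p ℚ.- r
  lemma = solve 3 (λ p q r → (p :- q) :+ (q :- r) := p :- r) refl

<+⇒-< : ∀ p q r → p ℚ.< r ℚ.+ q → p ℚ.- q ℚ.< r
<+⇒-< p q r h = subst (p ℚ.- q ℚ.<_) (cancel r q) (ℚ.+-monoˡ-< (ℚ.- q) h)
  where
  open ℚS
  cancel : ∀ p q → (p ℚ.+ q) ℚ.- q ≡ p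
  cancel = solve 2 (λ p q → (p :+ q) :- q := p) refl

∣∣-bound : ∀ {p q r} → p ℚ.- q ℚ.< r → q ℚ.- p ℚ.< r → ∣ p ℚ.- q ∣ ℚ.< r
∣∣-bound {p} {q} {r} h₁ h₂ with ℚ.∣p∣≡p∨∣p∣≡-p (p ℚ.- q)
... | inj₁ eq = subst (ℚ._< r) (sym eq) h₁
... | inj₂ eq = subst (ℚ._< r) (sym (trans eq (neg-diff p q))) h₂

-- The reals are Cauchy sequences of rationals; equality _≈_ is equality up to a
-- null sequence, so a function ℝ → ℝ is a Func ℝ-setoid ℝ-setoid.

IsCauchy : (ℕ → ℚ) → Set
IsCauchy x = ∀ ε → 0ℚ ℚ.< ε → ∃[ N ] (∀ m n → N ℕ.≤ m → N ℕ.≤ n → ∣ x m ℚ.- x n ∣ ℚ.< ε)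

record ℝ : Set where
  constructor mkℝ
  field
    seq    : ℕ → ℚ
    cauchy : IsCauchy seq

open ℝ public

infix 4 _≈_ _<_ _≤_ _#_

_≈_ : ℝ → ℝ → Set
x ≈ y = ∀ ε → 0ℚ ℚ.< ε → ∃[ N ] (∀ n → N ℕ.≤ n → ∣ seq x n ℚ.- seq y n ∣ ℚ.< ε)

_<_ : ℝ → ℝ → Set
x < y = ∃[ ε ] (0ℚ ℚ.< ε × ∃[ N ] (∀ n → N ℕ.≤ n → seq x n ℚ.+ ε ℚ.≤ seq y n))

_≤_ : ℝ → ℝ → Set
x ≤ y = ¬ (y < x)

-- The positive form of x ≠ y; classically equivalent to ¬ (x ≈ y).
_#_ : ℝ → ℝ → Set
x # y = x < y ⊎ y < x

≈-refl : ∀ {x} → x ≈ x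
≈-refl {x} ε 0<ε =
  0 , λ n _ → subst (λ p → ∣ p ∣ ℚ.< ε) (sym (ℚ.+-inverseʳ (seq x n))) 0<ε

≈-sym : ∀ {x y} → x ≈ y → y ≈ x
≈-sym {x} {y} x≈y ε 0<ε =
  let N , h = x≈y ε 0<ε in
  N , λ n N≤n → subst (ℚ._< ε) (-‿swap (seq x n) (seq y n)) (h n N≤n)

≈-trans : ∀ {x y z} → x ≈ y → y ≈ z → x ≈ z
≈-trans {x} {y} {z} x≈y y≈z ε 0<ε =
  let N₁ , h₁ = x≈y (½ ℚ.* ε) (half-pos 0<ε)
      N₂ , h₂ = y≈z (½ ℚ.* ε) (half-pos 0<ε)
  in N₁ ℕ.⊔ N₂ , λ n N≤n →
    ℚ.≤-<-trans (-‿triangle (seq x n) (seq y n) (seq z n))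
      (subst (_ ℚ.<_) (halve ε)
        (ℚ.+-mono-< (h₁ n (ℕ.≤-trans (ℕ.m≤m⊔n N₁ N₂) N≤n))
                    (h₂ n (ℕ.≤-trans (ℕ.m≤n⊔m N₁ N₂) N≤n))))

ℝ-setoid : Setoid 0ℓ 0ℓ
ℝ-setoid = record
  { Carrier = ℝ
  ; _≈_ = _≈_
  ; isEquivalence = record
    { refl  = λ {x} → ≈-refl {x}
    ; sym   = λ {x} {y} → ≈-sym {x} {y}
    ; trans = λ {x} {y} {z} → ≈-trans {x} {y} {z}
    }
  }

fromℚ : ℚ → ℝ
fromℚ q = mkℝ (λ _ → q) λ ε 0<ε →
  0 , λ _ _ _ _ → subst (λ p → ∣ p ∣ ℚ.< ε) (sym (ℚ.+-inverseʳ q)) 0<ε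

fromℕ : ℕ → ℝ
fromℕ n = fromℚ (+ n ℚ./ 1)

0ℝ 1ℝ : ℝ
0ℝ = fromℚ 0ℚ
1ℝ = fromℚ 1ℚ

infixl 6 _+_ _-_
infixl 7 _*_
infix  8 -_

_+_ : ℝ → ℝ → ℝ
x + y = mkℝ (λ n → seq x n ℚ.+ seq y n) λ ε 0<ε →
  let N₁ , h₁ = cauchy x (½ ℚ.* ε) (half-pos 0<ε)
      N₂ , h₂ = cauchy y (½ ℚ.* ε) (half-pos 0<ε)
  in N₁ ℕ.⊔ N₂ , λ m n N≤m N≤n →
    ℚ.≤-<-trans
      (∣∣-triangle (seq x m ℚ.- seq x n) (seq y m ℚ.- seq y n)
        (lemma (seq x m) (seq x n) (seq y m) (seq y n)))
      (subst (_ ℚ.<_) (halve ε)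
        (ℚ.+-mono-<
          (h₁ m n (ℕ.≤-trans (ℕ.m≤m⊔n N₁ N₂) N≤m) (ℕ.≤-trans (ℕ.m≤m⊔n N₁ N₂) N≤n))
          (h₂ m n (ℕ.≤-trans (ℕ.m≤n⊔m N₁ N₂) N≤m) (ℕ.≤-trans (ℕ.m≤n⊔m N₁ N₂) N≤n))))
  where
  open ℚS
  lemma : ∀ a b c d → (a ℚ.- b) ℚ.+ (c ℚ.- d) ≡ (a ℚ.+ c) ℚ.- (b ℚ.+ d)
  lemma = solve 4 (λ a b c d → (a :- b) :+ (c :- d) := (a :+ c) :- (b :+ d)) refl

-_ : ℝ → ℝ
- x = mkℝ (λ n → ℚ.- seq x n) λ ε 0<ε →
  let N , h = cauchy x ε 0<ε in
  N , λ m n N≤m N≤n → subst (λ p → ∣ p ∣ ℚ.< ε) (lemma (seq x n) (seq x m)) (h n m N≤n N≤m)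
  where
  open ℚS
  lemma : ∀ a b → a ℚ.- b ≡ (ℚ.- b) ℚ.- (ℚ.- a)
  lemma = solve 2 (λ a b → a :- b := (:- b) :- (:- a)) refl

_-_ : ℝ → ℝ → ℝ
x - y = x + (- y)

eventuallyBounded : ∀ x → Σ[ K ∈ ℚ ] (0ℚ ℚ.< K × ∃[ N ] (∀ n → N ℕ.≤ n → ∣ seq x n ∣ ℚ.≤ K))
eventuallyBounded x =
  let N , h = cauchy x 1ℚ (ℚ.positive⁻¹ 1ℚ)
      a     = seq x N
  in 1ℚ ℚ.+ ∣ a ∣ ,
     ℚ.+-mono-<-≤ (ℚ.positive⁻¹ 1ℚ) (ℚ.0≤∣p∣ a) ,
     N , λ n N≤n →
       ℚ.≤-trans
         (∣∣-triangle (seq x n ℚ.- a) a (lemma (seq x n) a))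
         (ℚ.+-monoˡ-≤ ∣ a ∣ (ℚ.<⇒≤ (h n N N≤n ℕ.≤-refl)))
  where
  open ℚS
  lemma : ∀ p q → (p ℚ.- q) ℚ.+ q ≡ p
  lemma = solve 2 (λ p q → (p :- q) :+ q := p) refl

divide : ∀ K ε → 0ℚ ℚ.< K → 0ℚ ℚ.< ε → Σ[ δ ∈ ℚ ] (0ℚ ℚ.< δ × K ℚ.* δ ≡ ε)
divide K ε 0<K 0<ε =
  1/K ℚ.* ε ,
  subst (ℚ._< 1/K ℚ.* ε) (ℚ.*-zeroʳ 1/K) (ℚ.*-monoʳ-<-pos 1/K 0<ε) ,
  trans (sym (ℚ.*-assoc K 1/K ε)) (trans (cong (ℚ._* ε) (ℚ.*-inverseʳ K)) (ℚ.*-identityˡ ε))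
  where
  instance
    posK : ℚ.Positive K
    posK = ℚ.positive 0<K
    nonZeroK : ℚ.NonZero K
    nonZeroK = ℚ.pos⇒nonZero K
  1/K = ℚ.1/ K
  instance
    pos1/K : ℚ.Positive 1/K
    pos1/K = ℚ.1/pos⇒pos K

∣∣-*-bound : ∀ {p q K δ} → 0ℚ ℚ.< K → ∣ p ∣ ℚ.≤ K → ∣ q ∣ ℚ.< δ → ∣ p ℚ.* q ∣ ℚ.< K ℚ.* δ
∣∣-*-bound {p} {q} {K} {δ} 0<K p≤K q<δ =
  subst (ℚ._< K ℚ.* δ) (sym (ℚ.∣p*q∣≡∣p∣*∣q∣ p q))
    (ℚ.≤-<-trans
      (ℚ.*-monoʳ-≤-nonNeg ∣ q ∣ {{ℚ.nonNegative (ℚ.0≤∣p∣ q)}} p≤K)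
      (ℚ.*-monoʳ-<-pos K {{ℚ.positive 0<K}} q<δ))

_*_ : ℝ → ℝ → ℝ
x * y = mkℝ (λ n → seq x n ℚ.* seq y n) λ ε 0<ε →
  let K , 0<K , N₁ , bx = eventuallyBounded x
      L , 0<L , N₂ , by = eventuallyBounded y
      δ , 0<δ , Kδ = divide K (½ ℚ.* ε) 0<K (half-pos 0<ε)
      η , 0<η , Lη = divide L (½ ℚ.* ε) 0<L (half-pos 0<ε)
      N₃ , hy = cauchy y δ 0<δ
      N₄ , hx = cauchy x η 0<η
      M = (N₁ ℕ.⊔ N₂) ℕ.⊔ (N₃ ℕ.⊔ N₄)
      M₁₂ = ℕ.m≤m⊔n (N₁ ℕ.⊔ N₂) (N₃ ℕ.⊔ N₄)
      M₃₄ = ℕ.m≤n⊔m (N₁ ℕ.⊔ N₂) (N₃ ℕ.⊔ N₄)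
      M₁ = ℕ.≤-trans (ℕ.m≤m⊔n N₁ N₂) M₁₂
      M₂ = ℕ.≤-trans (ℕ.m≤n⊔m N₁ N₂) M₁₂
      M₃ = ℕ.≤-trans (ℕ.m≤m⊔n N₃ N₄) M₃₄
      M₄ = ℕ.≤-trans (ℕ.m≤n⊔m N₃ N₄) M₃₄
  in M , λ m n M≤m M≤n →
    ℚ.≤-<-trans
      (∣∣-triangle (seq x m ℚ.* (seq y m ℚ.- seq y n)) (seq y n ℚ.* (seq x m ℚ.- seq x n))
        (lemma (seq x m) (seq x n) (seq y m) (seq y n)))
      (subst (_ ℚ.<_) (trans (cong₂ ℚ._+_ Kδ Lη) (halve ε))
        (ℚ.+-mono-<
          (∣∣-*-bound {seq x m} 0<K (bx m (ℕ.≤-trans M₁ M≤m))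
            (hy m n (ℕ.≤-trans M₃ M≤m) (ℕ.≤-trans M₃ M≤n)))
          (∣∣-*-bound {seq y n} 0<L (by n (ℕ.≤-trans M₂ M≤n))
            (hx m n (ℕ.≤-trans M₄ M≤m) (ℕ.≤-trans M₄ M≤n)))))
  where
  open ℚS
  lemma : ∀ a b c d → a ℚ.* (c ℚ.- d) ℚ.+ d ℚ.* (a ℚ.- b) ≡ a ℚ.* c ℚ.- b ℚ.* d
  lemma = solve 4 (λ a b c d → a :* (c :- d) :+ d :* (a :- b) := a :* c :- b :* d) refl

-- The greatest j ≤ b with j ^ d ≤ N, if there is one.
searchRoot : (d N b : ℕ) → ℕ
searchRoot d N zero = zero
searchRoot d N (suc b) with suc b ℕ.^ d ℕ.≤? N
... | yes _ = suc b
... | no  _ = searchRoot d N b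

⌊root⌋ : (d N : ℕ) → ℕ
⌊root⌋ d N = searchRoot d N N

searchRoot-lower : ∀ d .{{_ : ℕ.NonZero d}} N b → searchRoot d N b ℕ.^ d ℕ.≤ N
searchRoot-lower (suc d) N zero = ℕ.z≤n
searchRoot-lower d N (suc b) with suc b ℕ.^ d ℕ.≤? N
... | yes p = p
... | no  _ = searchRoot-lower d N b

searchRoot-upper : ∀ d N b → N ℕ.< suc b ℕ.^ d → N ℕ.< suc (searchRoot d N b) ℕ.^ d
searchRoot-upper d N zero    h = h
searchRoot-upper d N (suc b) h with suc b ℕ.^ d ℕ.≤? N
... | yes _ = h
... | no ¬p = searchRoot-upper d N b (ℕ.≰⇒> ¬p)

m≤m^1+n : ∀ m n .{{_ : ℕ.NonZero m}} → m ℕ.≤ m ℕ.^ suc n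
m≤m^1+n m n = subst (ℕ._≤ m ℕ.^ suc n) (ℕ.*-identityʳ m) (ℕ.*-monoʳ-≤ m (ℕ.m^n>0 m n))

⌊root⌋-lower : ∀ d .{{_ : ℕ.NonZero d}} N → ⌊root⌋ d N ℕ.^ d ℕ.≤ N
⌊root⌋-lower d N = searchRoot-lower d N N

⌊root⌋-upper : ∀ d .{{_ : ℕ.NonZero d}} N → N ℕ.< suc (⌊root⌋ d N) ℕ.^ d
⌊root⌋-upper (suc d) N = searchRoot-upper (suc d) N N (m≤m^1+n (suc N) d)

-- ⌊ (n + 1) a^(1/d) ⌋ / (n + 1), which is within 1 / (n + 1) of a^(1/d).
rootSeq : (d a : ℕ) → ℕ → ℚ
rootSeq d a n = + ⌊root⌋ d (a ℕ.* suc n ℕ.^ d) ℚ./ suc n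

^-distribʳ-* : ∀ d m n → (m ℕ.* n) ℕ.^ d ≡ m ℕ.^ d ℕ.* n ℕ.^ d
^-distribʳ-* zero    m n = refl
^-distribʳ-* (suc d) m n =
  trans (cong (m ℕ.* n ℕ.*_) (^-distribʳ-* d m n)) (lemma m n (m ℕ.^ d) (n ℕ.^ d))
  where
  open +-*-Solver
  lemma : ∀ a b c d → a ℕ.* b ℕ.* (c ℕ.* d) ≡ a ℕ.* c ℕ.* (b ℕ.* d)
  lemma = solve 4 (λ a b c d → a :* b :* (c :* d) := a :* c :* (b :* d)) refl

^-cancelˡ-< : ∀ d {m n} → m ℕ.^ d ℕ.< n ℕ.^ d → m ℕ.< n
^-cancelˡ-< d {m} {n} h with m ℕ.<? n
... | yes p = p
... | no ¬p with () ← ℕ.<⇒≱ h (ℕ.^-monoˡ-≤ d (ℕ.≮⇒≥ ¬p))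

cross : ∀ d .{{_ : ℕ.NonZero d}} a m n →
        ⌊root⌋ d (a ℕ.* suc m ℕ.^ d) ℕ.* suc n ℕ.< suc (⌊root⌋ d (a ℕ.* suc n ℕ.^ d)) ℕ.* suc m
cross d a m n = ^-cancelˡ-< d (begin-strict
  (i ℕ.* suc n) ℕ.^ d                   ≡⟨ ^-distribʳ-* d i (suc n) ⟩
  i ℕ.^ d ℕ.* suc n ℕ.^ d               ≤⟨ ℕ.*-monoˡ-≤ (suc n ℕ.^ d) (⌊root⌋-lower d (a ℕ.* suc m ℕ.^ d)) ⟩
  a ℕ.* suc m ℕ.^ d ℕ.* suc n ℕ.^ d     ≡⟨ lemma a (suc m ℕ.^ d) (suc n ℕ.^ d) ⟩
  a ℕ.* suc n ℕ.^ d ℕ.* suc m ℕ.^ d     <⟨ ℕ.*-monoˡ-< (suc m ℕ.^ d) {{ℕ.m^n≢0 (suc m) d}} (⌊root⌋-upper d (a ℕ.* suc n ℕ.^ d)) ⟩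
  suc j ℕ.^ d ℕ.* suc m ℕ.^ d           ≡⟨ ^-distribʳ-* d (suc j) (suc m) ⟨
  (suc j ℕ.* suc m) ℕ.^ d               ∎)
  where
  open ℕ.≤-Reasoning
  i = ⌊root⌋ d (a ℕ.* suc m ℕ.^ d)
  j = ⌊root⌋ d (a ℕ.* suc n ℕ.^ d)
  open +-*-Solver
  lemma : ∀ a b c → a ℕ.* b ℕ.* c ≡ a ℕ.* c ℕ.* b
  lemma = solve 3 (λ a b c → a :* b :* c := a :* c :* b) refl

/-homo-+ : ∀ i j n → (+ i ℚ./ suc n) ℚ.+ (+ j ℚ./ suc n) ≡ + (i ℕ.+ j) ℚ./ suc n
/-homo-+ i j n = ℚ.toℚᵘ-injective (begin
  ℚ.toℚᵘ ((+ i ℚ./ suc n) ℚ.+ (+ j ℚ./ suc n))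
    ≈⟨ ℚ.toℚᵘ-homo-+ (+ i ℚ./ suc n) (+ j ℚ./ suc n) ⟩
  ℚ.toℚᵘ (+ i ℚ./ suc n) ℚᵘ.+ ℚ.toℚᵘ (+ j ℚ./ suc n)
    ≈⟨ ℚᵘ.+-cong (ℚ.toℚᵘ-fromℚᵘ (ℚᵘ.mkℚᵘ (+ i) n)) (ℚ.toℚᵘ-fromℚᵘ (ℚᵘ.mkℚᵘ (+ j) n)) ⟩
  ℚᵘ.mkℚᵘ (+ i) n ℚᵘ.+ ℚᵘ.mkℚᵘ (+ j) n
    ≈⟨ ℚᵘ.*≡* (trans (cong (ℤ._* + suc n) (sym (ℤ.*-distribʳ-+ (+ suc n) (+ i) (+ j))))
                     (ℤ.*-assoc (+ (i ℕ.+ j)) (+ suc n) (+ suc n))) ⟩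
  ℚᵘ.mkℚᵘ (+ (i ℕ.+ j)) n
    ≈⟨ ℚ.toℚᵘ-fromℚᵘ (ℚᵘ.mkℚᵘ (+ (i ℕ.+ j)) n) ⟨
  ℚ.toℚᵘ (+ (i ℕ.+ j) ℚ./ suc n) ∎)
  where open import Relation.Binary.Reasoning.Setoid ℚᵘ.≃-setoid

/-< : ∀ i j m n → i ℕ.* suc n ℕ.< j ℕ.* suc m → + i ℚ./ suc m ℚ.< + j ℚ./ suc n
/-< i j m n h = ℚ.toℚᵘ-cancel-<
  (ℚᵘ.<-respˡ-≃ (ℚᵘ.≃-sym (ℚ.toℚᵘ-fromℚᵘ (ℚᵘ.mkℚᵘ (+ i) m)))
    (ℚᵘ.<-respʳ-≃ (ℚᵘ.≃-sym (ℚ.toℚᵘ-fromℚᵘ (ℚᵘ.mkℚᵘ (+ j) n)))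
      (ℚᵘ.*<* (subst₂ ℤ._<_ (ℤ.pos-* i (suc n)) (ℤ.pos-* j (suc m)) (ℤ.+<+ h)))))

rootSeq-close : ∀ d .{{_ : ℕ.NonZero d}} a m n →
                rootSeq d a m ℚ.- rootSeq d a n ℚ.< + 1 ℚ./ suc n
rootSeq-close d a m n =
  <+⇒-< (rootSeq d a m) (rootSeq d a n) (+ 1 ℚ./ suc n)
    (subst (rootSeq d a m ℚ.<_) (sym (/-homo-+ 1 j n)) (/-< i (suc j) m n (cross d a m n)))
  where
  i = ⌊root⌋ d (a ℕ.* suc m ℕ.^ d)
  j = ⌊root⌋ d (a ℕ.* suc n ℕ.^ d)

archimedean : ∀ ε → 0ℚ ℚ.< ε → ∃[ N ] (∀ n → N ℕ.≤ n → + 1 ℚ./ suc n ℚ.< ε)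
archimedean ε 0<ε = aux ε (ℚ.positive 0<ε)
  where
  aux : ∀ ε → ℚ.Positive ε → ∃[ N ] (∀ n → N ℕ.≤ n → + 1 ℚ./ suc n ℚ.< ε)
  aux (mkℚ (+ suc p) q-1 c) _ = suc q-1 , λ n N≤n →
    ℚ.toℚᵘ-cancel-<
      (ℚᵘ.<-respˡ-≃ (ℚᵘ.≃-sym (ℚ.toℚᵘ-fromℚᵘ (ℚᵘ.mkℚᵘ (+ 1) n)))
        (ℚᵘ.*<* (subst₂ ℤ._<_ (ℤ.pos-* 1 (suc q-1)) (ℤ.pos-* (suc p) (suc n))
          (ℤ.+<+ (ℕ.≤-trans (ℕ.s≤s (ℕ.≤-trans (ℕ.≤-reflexive (ℕ.*-identityˡ (suc q-1))) N≤n))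
                            (ℕ.m≤n*m (suc n) (suc p)))))))

root : (d : ℕ) .{{_ : ℕ.NonZero d}} → ℕ → ℝ
root d a = mkℝ (rootSeq d a) λ ε 0<ε →
  let N , h = archimedean ε 0<ε in
  N , λ m n N≤m N≤n →
    ∣∣-bound {rootSeq d a m} {rootSeq d a n}
      (ℚ.<-trans (rootSeq-close d a m n) (h n N≤n))
      (ℚ.<-trans (rootSeq-close d a n m) (h m N≤m))

-- X is enumerated without repetition by Fin n, where repetition and membership
-- are both up to _≈_.
HasCardinality : Pred ℝ 0ℓ → ℕ → Set
HasCardinality X n =
  Σ[ f ∈ (Fin n → ℝ) ] (Injective _≡_ _≈_ f × (∀ x → X x ⇔ (∃[ i ] x ≈ f i)))

infixl 6 _⊕_

_⊕_ : Pred ℝ 0ℓ → Pred ℝ 0ℓ → Pred ℝ 0ℓ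
(X ⊕ Y) z = ∃[ x ] ∃[ y ] (X x × Y y × z ≈ x + y)

image : Func ℝ-setoid ℝ-setoid → Pred ℝ 0ℓ → Pred ℝ 0ℓ
image F X y = ∃[ x ] (X x × y ≈ F ⟨$⟩ x)

StrictlyConvex : Func ℝ-setoid ℝ-setoid → Set
StrictlyConvex F = ∀ x y t → x # y → 0ℝ < t → t < 1ℝ →
  F ⟨$⟩ (t * x + (1ℝ - t) * y) < t * (F ⟨$⟩ x) + (1ℝ - t) * (F ⟨$⟩ y)

{-# OPTIONS --safe #-}
module Submission where

-- Restrict to half of A, sorted as a₀ < … < a_K, on which F is monotone, and put S = A + B, T = F(A) + C,
-- of sizes m and n. For fixed b the steps from aᵢ + b to aᵢ₊₁ + b cut S into consecutive blocks, so at most a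
-- quarter of them pass over more than 4m/K elements of S, and similarly for F(aᵢ) + c in T. Hence for at least
-- K k²/2 triples (i, b, c) both steps are short. Strict convexity makes (aᵢ₊₁ − aᵢ, F(aᵢ₊₁) − F(aᵢ)) determine
-- i, so the triple is determined by the two pairs of end points, which leaves at most
-- m (4m/K) n (4n/K) possibilities. Thus K³k² ≤ 32 m²n².
-- The conclusion is a decidable inequality between naturals, so the order of finitely many reals may be decided
-- under a double negation.

open import Defs
open import Data.Fin.Base as Fin
  using (Fin; zero; suc; toℕ; inject₁; inject≤; fromℕ<; opposite; punchOut; _↑ˡ_; _↑ʳ_)
import Data.Fin.Properties as Fin
open import Data.Fin.Subset as Subset using (Subset; _∈_; _∉_)
open import Data.Fin.Subset.Properties using (p⊂q⇒∣p∣<∣q∣; ∣⊤∣≡n; ∈⊤)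
open import Data.Integer.Base as ℤ using (+_)
import Data.Integer.Properties as ℤ
open import Data.Nat.Base as ℕ using (ℕ; zero; suc; _^_; _⊔_; ⌈_/2⌉; NonZero; z≤n; s≤s)
open import Data.Nat.DivMod using (m≡m%n+[m/n]*n; m%n<n; m/n*n≤m)
import Data.Nat.Properties as ℕ
open import Data.Nat.Solver using (module +-*-Solver)
open import Data.Product.Base using (Σ-syntax; ∃-syntax; _×_; _,_; proj₁; proj₂)
open import Data.Product.Function.NonDependent.Propositional using (_×-↔_)
open import Data.Product.Properties using (,-injective)
open import Data.Rational.Base as ℚ using (ℚ; 0ℚ; 1ℚ; ½; ∣_∣)
import Data.Rational.Properties as ℚ
import Data.Rational.Unnormalised.Base as ℚᵘ
import Data.Rational.Unnormalised.Properties as ℚᵘ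
open import Data.Sum.Base using (_⊎_; inj₁; inj₂; [_,_]′)
open import Data.Vec.Base using (tabulate)
open import Data.Vec.Properties using (lookup∘tabulate; []=⇒lookup; lookup⇒[]=)
open import Effect.Monad using (RawMonad)
open import Function.Base using (_∘_)
open import Function.Bundles using (Func; _⟨$⟩_; _↔_; mk↣; module Equivalence; module Injection)
open import Function.Construct.Composition using (_↔-∘_; _↣-∘_)
open import Function.Construct.Identity using (↔-id)
open import Function.Construct.Symmetry using (↔-sym)
open import Function.Definitions using (Injective)
open import Function.Properties.Inverse using (↔⇒↣)
open import Level using (0ℓ)
open import Relation.Binary.Definitions using (Tri; tri<; tri≈; tri>)
open import Relation.Binary.PropositionalEquality hiding ([_])
open import Relation.Nullary using (¬_; Dec; does; yes; no; contradiction)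
open import Relation.Nullary.Decidable using (dec-true; decidable-stable; toWitness)
open import Relation.Nullary.Negation using (¬¬-Monad)
open import Relation.Unary using (Pred)

-- Real numbers

<⇒≱ : ∀ {p q} → p ℚ.< q → ¬ (q ℚ.≤ p)
<⇒≱ p<q q≤p = ℚ.<-irrefl refl (ℚ.<-≤-trans p<q q≤p)

-- Linear arithmetic over ℚ: add up the hypotheses, then compare differences with the ring solver.
shift-≤ : ∀ {p q r s} → p ℚ.≤ q → q ℚ.- p ≡ s ℚ.- r → r ℚ.≤ s
shift-≤ {p} {q} {r} {s} p≤q eq = subst₂ ℚ._≤_ (lemma p r) eq′ (ℚ.+-monoˡ-≤ (r ℚ.- p) p≤q)
  where
  open ℚS
  lemma : ∀ p r → p ℚ.+ (r ℚ.- p) ≡ r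
  lemma = solve 2 (λ p r → p :+ (r :- p) := r) refl
  lemma₂ : ∀ q p r → q ℚ.+ (r ℚ.- p) ≡ (q ℚ.- p) ℚ.+ r
  lemma₂ = solve 3 (λ q p r → q :+ (r :- p) := (q :- p) :+ r) refl
  lemma₃ : ∀ s r → (s ℚ.- r) ℚ.+ r ≡ s
  lemma₃ = solve 2 (λ s r → (s :- r) :+ r := s) refl
  eq′ : q ℚ.+ (r ℚ.- p) ≡ s
  eq′ = trans (lemma₂ q p r) (trans (cong (ℚ._+ r) eq) (lemma₃ s r))

p≤∣p∣ : ∀ p → p ℚ.≤ ∣ p ∣
p≤∣p∣ p with ℚ.≤-total 0ℚ p
... | inj₁ 0≤p = ℚ.≤-reflexive (sym (ℚ.0≤p⇒∣p∣≡p 0≤p))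
... | inj₂ p≤0 = ℚ.≤-trans p≤0 (ℚ.0≤∣p∣ p)

∣p-q∣<r⇒p-q<r : ∀ p q {r} → ∣ p ℚ.- q ∣ ℚ.< r → p ℚ.- q ℚ.< r
∣p-q∣<r⇒p-q<r p q = ℚ.≤-<-trans (p≤∣p∣ (p ℚ.- q))

∣p-q∣<r⇒q-p<r : ∀ p q {r} → ∣ p ℚ.- q ∣ ℚ.< r → q ℚ.- p ℚ.< r
∣p-q∣<r⇒q-p<r p q {r} h = ∣p-q∣<r⇒p-q<r q p (subst (ℚ._< r) (-‿swap p q) h)

*-pos : ∀ {p q} → 0ℚ ℚ.< p → 0ℚ ℚ.< q → 0ℚ ℚ.< p ℚ.* q
*-pos {p} {q} 0<p 0<q = subst (ℚ._< p ℚ.* q) (ℚ.*-zeroʳ p) (ℚ.*-monoʳ-<-pos p {{ℚ.positive 0<p}} 0<q)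

<-irrefl : ∀ {x} → ¬ (x < x)
<-irrefl {x} (ε , 0<ε , N , h) =
  <⇒≱ 0<ε (shift-≤ (h N ℕ.≤-refl) (lemma (seq x N) ε))
  where
  open ℚS
  lemma : ∀ p e → p ℚ.- (p ℚ.+ e) ≡ 0ℚ ℚ.- e
  lemma = solve 2 (λ p e → p :- (p :+ e) := con 0ℚ :- e) refl

+-mono-< : ∀ {x y z w} → x < y → z < w → x + z < y + w
+-mono-< {x} {y} {z} {w} (ε , 0<ε , N , h) (δ , 0<δ , M , g) =
  ε ℚ.+ δ , ℚ.+-mono-< 0<ε 0<δ , N ⊔ M , λ n le →
    shift-≤ (ℚ.+-mono-≤ (h n (ℕ.≤-trans (ℕ.m≤m⊔n N M) le)) (g n (ℕ.≤-trans (ℕ.m≤n⊔m N M) le)))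
      (lemma (seq x n) (seq y n) (seq z n) (seq w n) ε δ)
  where
  open ℚS
  lemma : ∀ x y z w e d → (y ℚ.+ w) ℚ.- ((x ℚ.+ e) ℚ.+ (z ℚ.+ d)) ≡ (y ℚ.+ w) ℚ.- ((x ℚ.+ z) ℚ.+ (e ℚ.+ d))
  lemma = solve 6 (λ x y z w e d → (y :+ w) :- ((x :+ e) :+ (z :+ d)) := (y :+ w) :- ((x :+ z) :+ (e :+ d))) refl

<-trans : ∀ {x y z} → x < y → y < z → x < z
<-trans {x} {y} {z} (ε , 0<ε , N , h) (δ , 0<δ , M , g) =
  ε ℚ.+ δ , ℚ.+-mono-< 0<ε 0<δ , N ⊔ M , λ n le →
    shift-≤ (ℚ.+-mono-≤ (h n (ℕ.≤-trans (ℕ.m≤m⊔n N M) le)) (g n (ℕ.≤-trans (ℕ.m≤n⊔m N M) le)))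
      (lemma (seq x n) (seq y n) (seq z n) ε δ)
  where
  open ℚS
  lemma : ∀ x y z e d → (y ℚ.+ z) ℚ.- ((x ℚ.+ e) ℚ.+ (y ℚ.+ d)) ≡ z ℚ.- (x ℚ.+ (e ℚ.+ d))
  lemma = solve 5 (λ x y z e d → (y :+ z) :- ((x :+ e) :+ (y :+ d)) := z :- (x :+ (e :+ d))) refl

<-asym : ∀ {x y} → x < y → ¬ (y < x)
<-asym {x} {y} x<y y<x = <-irrefl {x} (<-trans {x} {y} {x} x<y y<x)

<-respʳ-≈ : ∀ {x y z} → y ≈ z → x < y → x < z
<-respʳ-≈ {x} {y} {z} y≈z (ε , 0<ε , N , h) =
  let M , g = y≈z (½ ℚ.* ε) (half-pos 0<ε) in
  ½ ℚ.* ε , half-pos 0<ε , N ⊔ M , λ n le →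
    shift-≤ (ℚ.+-mono-≤ (h n (ℕ.≤-trans (ℕ.m≤m⊔n N M) le))
        (ℚ.<⇒≤ (∣p-q∣<r⇒p-q<r (seq y n) (seq z n) (g n (ℕ.≤-trans (ℕ.m≤n⊔m N M) le)))))
      (lemma (seq x n) (seq y n) (seq z n) ε)
  where
  open ℚS
  lemma : ∀ x y z e → (y ℚ.+ ½ ℚ.* e) ℚ.- ((x ℚ.+ e) ℚ.+ (y ℚ.- z)) ≡ z ℚ.- (x ℚ.+ ½ ℚ.* e)
  lemma = solve 4 (λ x y z e → (y :+ con ½ :* e) :- ((x :+ e) :+ (y :- z)) := z :- (x :+ con ½ :* e)) refl

<-respˡ-≈ : ∀ {x y z} → x ≈ y → x < z → y < z
<-respˡ-≈ {x} {y} {z} x≈y (ε , 0<ε , N , h) =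
  let M , g = x≈y (½ ℚ.* ε) (half-pos 0<ε) in
  ½ ℚ.* ε , half-pos 0<ε , N ⊔ M , λ n le →
    shift-≤ (ℚ.+-mono-≤ (h n (ℕ.≤-trans (ℕ.m≤m⊔n N M) le))
        (ℚ.<⇒≤ (∣p-q∣<r⇒q-p<r (seq x n) (seq y n) (g n (ℕ.≤-trans (ℕ.m≤n⊔m N M) le)))))
      (lemma (seq x n) (seq y n) (seq z n) ε)
  where
  open ℚS
  lemma : ∀ x y z e → (z ℚ.+ ½ ℚ.* e) ℚ.- ((x ℚ.+ e) ℚ.+ (y ℚ.- x)) ≡ z ℚ.- (y ℚ.+ ½ ℚ.* e)
  lemma = solve 4 (λ x y z e → (z :+ con ½ :* e) :- ((x :+ e) :+ (y :- x)) := z :- (y :+ con ½ :* e)) refl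

≈⇒≮ : ∀ {x y} → x ≈ y → ¬ (x < y)
≈⇒≮ {x} {y} x≈y x<y = <-irrefl {y} (<-respˡ-≈ {x} {y} {y} x≈y x<y)

-- Beyond the Cauchy moduli for ε/4 each of the two sequences moves by less than ε/4, so a gap of ε
-- at a single index leaves ε/2 at all later ones. An inequality between reals can thus be read off
-- from one pair of rationals.
locate : ∀ x y ε → 0ℚ ℚ.< ε → ∃[ N ] (∀ n → N ℕ.≤ n → seq x n ℚ.+ ε ℚ.≤ seq y n → x < y)
locate x y ε 0<ε =
  let ¼ε = ½ ℚ.* (½ ℚ.* ε)
      0<½ε = half-pos 0<ε
      N₁ , h₁ = cauchy x ¼ε (half-pos 0<½ε)
      N₂ , h₂ = cauchy y ¼ε (half-pos 0<½ε)
  in N₁ ⊔ N₂ , λ n N≤n gap → ½ ℚ.* ε , 0<½ε , N₁ ⊔ N₂ , λ i N≤i →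
    shift-≤
      (ℚ.+-mono-≤ gap (ℚ.<⇒≤ (ℚ.+-mono-<
        (∣p-q∣<r⇒p-q<r (seq x i) (seq x n)
          (h₁ i n (ℕ.≤-trans (ℕ.m≤m⊔n N₁ N₂) N≤i) (ℕ.≤-trans (ℕ.m≤m⊔n N₁ N₂) N≤n)))
        (∣p-q∣<r⇒p-q<r (seq y n) (seq y i)
          (h₂ n i (ℕ.≤-trans (ℕ.m≤n⊔m N₁ N₂) N≤n) (ℕ.≤-trans (ℕ.m≤n⊔m N₁ N₂) N≤i))))))
      (lemma (seq x n) (seq x i) (seq y n) (seq y i) ε)
  where
  open ℚS
  lemma : ∀ p p′ q q′ e →
    (q ℚ.+ (½ ℚ.* (½ ℚ.* e) ℚ.+ ½ ℚ.* (½ ℚ.* e))) ℚ.- ((p ℚ.+ e) ℚ.+ ((p′ ℚ.- p) ℚ.+ (q ℚ.- q′)))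
      ≡ q′ ℚ.- (p′ ℚ.+ ½ ℚ.* e)
  lemma = solve 5 (λ p p′ q q′ e →
    (q :+ (con ½ :* (con ½ :* e) :+ con ½ :* (con ½ :* e))) :- ((p :+ e) :+ ((p′ :- p) :+ (q :- q′)))
      := q′ :- (p′ :+ con ½ :* e)) refl

-- By `locate`, a gap of ε at a late index in either direction would prove one of the excluded
-- inequalities. The order of ℚ is decidable, so the terms differ by less than ε from there on.
≮-antisym : ∀ {x y} → ¬ (x < y) → ¬ (y < x) → x ≈ y
≮-antisym {x} {y} x≮y y≮x ε 0<ε =
  let N , h = locate x y ε 0<ε
      M , g = locate y x ε 0<ε
  in N ⊔ M , λ n le → ∣∣-bound {seq x n} {seq y n}
    (diff (seq x n) (seq y n) λ gap → y≮x (g n (ℕ.≤-trans (ℕ.m≤n⊔m N M) le) gap))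
    (diff (seq y n) (seq x n) λ gap → x≮y (h n (ℕ.≤-trans (ℕ.m≤m⊔n N M) le) gap))
  where
  diff : ∀ p q → ¬ (q ℚ.+ ε ℚ.≤ p) → p ℚ.- q ℚ.< ε
  diff p q ¬gap = <+⇒-< p q ε (subst (p ℚ.<_) (ℚ.+-comm q ε) (ℚ.≰⇒> ¬gap))

≈-eventually : ∀ {x y} N → (∀ n → N ℕ.≤ n → seq x n ≡ seq y n) → x ≈ y
≈-eventually {x} {y} N h ε 0<ε = N , λ n N≤n →
  subst (λ p → ∣ p ∣ ℚ.< ε) (sym (trans (cong (ℚ._- seq y n) (h n N≤n)) (ℚ.+-inverseʳ (seq y n)))) 0<ε

-- Since `≈` sees only the termwise differences, a ring identity over ℚ carries it from one pair to
-- another.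
≈-diff : ∀ {x y z w} → (∀ n → seq x n ℚ.- seq y n ≡ seq z n ℚ.- seq w n) → z ≈ w → x ≈ y
≈-diff eq z≈w ε 0<ε = let N , h = z≈w ε 0<ε in
  N , λ n N≤n → subst (λ p → ∣ p ∣ ℚ.< ε) (sym (eq n)) (h n N≤n)

+-cong-≈ : ∀ {x y z w} → x ≈ y → z ≈ w → x + z ≈ y + w
+-cong-≈ {x} {y} {z} {w} x≈y z≈w =
  ≈-trans {x + z} {y + z} {y + w}
    (≈-diff {x + z} {y + z} {x} {y} (λ n → lemma (seq x n) (seq y n) (seq z n)) x≈y)
    (≈-diff {y + z} {y + w} {z} {w} (λ n → lemma′ (seq y n) (seq z n) (seq w n)) z≈w)
  where
  open ℚS
  lemma : ∀ x y z → (x ℚ.+ z) ℚ.- (y ℚ.+ z) ≡ x ℚ.- y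
  lemma = solve 3 (λ x y z → (x :+ z) :- (y :+ z) := x :- y) refl
  lemma′ : ∀ y z w → (y ℚ.+ z) ℚ.- (y ℚ.+ w) ≡ z ℚ.- w
  lemma′ = solve 3 (λ y z w → (y :+ z) :- (y :+ w) := z :- w) refl

+-comm-≈ : ∀ x y → x + y ≈ y + x
+-comm-≈ x y = ≈-eventually {x + y} {y + x} 0 λ n _ → ℚ.+-comm (seq x n) (seq y n)

+-cancelˡ-≈ : ∀ {x x′ y y′} → x ≈ x′ → x + y ≈ x′ + y′ → y ≈ y′
+-cancelˡ-≈ {x} {x′} {y} {y′} x≈x′ eq =
  ≈-diff {y} {y′} {(x + y) + x′} {(x′ + y′) + x}
    (λ n → lemma (seq x n) (seq x′ n) (seq y n) (seq y′ n))
    (+-cong-≈ {x + y} {x′ + y′} {x′} {x} eq (≈-sym {x} {x′} x≈x′))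
  where
  open ℚS
  lemma : ∀ x x′ y y′ → y ℚ.- y′ ≡ ((x ℚ.+ y) ℚ.+ x′) ℚ.- ((x′ ℚ.+ y′) ℚ.+ x)
  lemma = solve 4 (λ x x′ y y′ → y :- y′ := ((x :+ y) :+ x′) :- ((x′ :+ y′) :+ x)) refl

+-monoˡ-< : ∀ {x y} z → x < y → x + z < y + z
+-monoˡ-< {x} {y} z (ε , 0<ε , N , h) = ε , 0<ε , N , λ n N≤n →
  shift-≤ (h n N≤n) (lemma (seq x n) (seq y n) (seq z n) ε)
  where
  open ℚS
  lemma : ∀ x y z e → y ℚ.- (x ℚ.+ e) ≡ (y ℚ.+ z) ℚ.- ((x ℚ.+ z) ℚ.+ e)
  lemma = solve 4 (λ x y z e → y :- (x :+ e) := (y :+ z) :- ((x :+ z) :+ e)) refl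

-- Equal differences y − x and y′ − x′, stated without subtraction.
translates : ∀ {x y x′ y′ b b′} → x + b ≈ x′ + b′ → y + b ≈ y′ + b′ → x + y′ ≈ x′ + y
translates {x} {y} {x′} {y′} {b} {b′} e₁ e₂ =
  ≈-diff {x + y′} {x′ + y} {(x + b) + (y′ + b′)} {(x′ + b′) + (y + b)}
    (λ n → lemma (seq x n) (seq y n) (seq x′ n) (seq y′ n) (seq b n) (seq b′ n))
    (+-cong-≈ {x + b} {x′ + b′} {y′ + b′} {y + b} e₁ (≈-sym {y + b} {y′ + b′} e₂))
  where
  open ℚS
  lemma : ∀ x y x′ y′ b b′ →
    (x ℚ.+ y′) ℚ.- (x′ ℚ.+ y) ≡ ((x ℚ.+ b) ℚ.+ (y′ ℚ.+ b′)) ℚ.- ((x′ ℚ.+ b′) ℚ.+ (y ℚ.+ b))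
  lemma = solve 6 (λ x y x′ y′ b b′ →
    (x :+ y′) :- (x′ :+ y) := ((x :+ b) :+ (y′ :+ b′)) :- ((x′ :+ b′) :+ (y :+ b))) refl

-- Multiply p ≤ q by the positive number r s.
reciprocal-antimono : ∀ {p q r s} → 0ℚ ℚ.< r → 0ℚ ℚ.< s → p ℚ.* r ≡ 1ℚ → q ℚ.* s ≡ 1ℚ → p ℚ.≤ q → s ℚ.≤ r
reciprocal-antimono {p} {q} {r} {s} 0<r 0<s pr≡1 qs≡1 p≤q = subst₂ ℚ._≤_
  (trans (sym (ℚ.*-assoc p r s)) (trans (cong (ℚ._* s) pr≡1) (ℚ.*-identityˡ s)))
  (trans (lemma q r s) (trans (cong (r ℚ.*_) qs≡1) (ℚ.*-identityʳ r)))
  (ℚ.*-monoʳ-≤-nonNeg (r ℚ.* s) {{ℚ.nonNegative (ℚ.<⇒≤ (*-pos 0<r 0<s))}} p≤q)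
  where
  open ℚS
  lemma : ∀ q r s → q ℚ.* (r ℚ.* s) ≡ r ℚ.* (q ℚ.* s)
  lemma = solve 3 (λ q r s → q :* (r :* s) := r :* (q :* s)) refl

-- Positive reals, reciprocals and convex weights.

0<-eventually : ∀ x → 0ℝ < x → Σ[ ε ∈ ℚ ] (0ℚ ℚ.< ε × ∃[ N ] (∀ n → N ℕ.≤ n → ε ℚ.≤ seq x n))
0<-eventually x (ε , 0<ε , N , h) = ε , 0<ε , N , λ n N≤n → subst (ℚ._≤ seq x n) (ℚ.+-identityˡ ε) (h n N≤n)

eventually-0< : ∀ x ε → 0ℚ ℚ.< ε → ∀ N → (∀ n → N ℕ.≤ n → ε ℚ.≤ seq x n) → 0ℝ < x
eventually-0< x ε 0<ε N h = ε , 0<ε , N , λ n N≤n → subst (ℚ._≤ seq x n) (sym (ℚ.+-identityˡ ε)) (h n N≤n)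

-- The product is 1 term by term from some index on, not merely up to `≈`, so that later identities
-- can be checked by the ring solver at each index.
reciprocal : ∀ w → 0ℝ < w →
  Σ[ v ∈ ℝ ] (0ℝ < v × ∃[ N ] (∀ n → N ℕ.≤ n → seq w n ℚ.* seq v n ≡ 1ℚ))
reciprocal w 0<w with 0<-eventually w 0<w
... | ε , 0<ε , N , ε≤w = v , 0<v , N , λ n N≤n → subst (λ p → p ℚ.* r n ≡ 1ℚ) (g≡w n N≤n) (gr≡1 n)
  where
  -- Truncating at ε makes every term invertible.
  g : ℕ → ℚ
  g n = ε ℚ.⊔ seq w n
  0<g : ∀ n → 0ℚ ℚ.< g n
  0<g n = ℚ.<-≤-trans 0<ε (ℚ.p≤p⊔q ε (seq w n))
  g≡w : ∀ n → N ℕ.≤ n → g n ≡ seq w n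
  g≡w n N≤n = ℚ.p≤q⇒p⊔q≡q (ε≤w n N≤n)
  1/g : ∀ n → Σ[ r ∈ ℚ ] (0ℚ ℚ.< r × g n ℚ.* r ≡ 1ℚ)
  1/g n = divide (g n) 1ℚ (0<g n) (ℚ.positive⁻¹ 1ℚ)
  r : ℕ → ℚ
  r n = proj₁ (1/g n)
  0<r : ∀ n → 0ℚ ℚ.< r n
  0<r n = proj₁ (proj₂ (1/g n))
  gr≡1 : ∀ n → g n ℚ.* r n ≡ 1ℚ
  gr≡1 n = proj₂ (proj₂ (1/g n))
  1/ε = divide ε 1ℚ 0<ε (ℚ.positive⁻¹ 1ℚ)
  κ = proj₁ 1/ε
  0<κ = proj₁ (proj₂ 1/ε)
  r≤κ : ∀ n → r n ℚ.≤ κ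
  r≤κ n = reciprocal-antimono 0<κ (0<r n) (proj₂ (proj₂ 1/ε)) (gr≡1 n) (ℚ.p≤p⊔q ε (seq w n))
  rr≤κκ : ∀ m n → ∣ r m ℚ.* r n ∣ ℚ.≤ κ ℚ.* κ
  rr≤κκ m n = subst (ℚ._≤ κ ℚ.* κ) (sym (ℚ.0≤p⇒∣p∣≡p (ℚ.<⇒≤ (*-pos (0<r m) (0<r n)))))
    (ℚ.≤-trans (ℚ.*-monoʳ-≤-nonNeg (r n) {{ℚ.nonNegative (ℚ.<⇒≤ (0<r n))}} (r≤κ m))
               (ℚ.*-monoˡ-≤-nonNeg κ {{ℚ.nonNegative (ℚ.<⇒≤ 0<κ)}} (r≤κ n)))
  -- Differences of reciprocals are differences of `g` scaled by a factor of at most κ², where κ =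
  -- 1/ε; hence `r` is Cauchy because `w` is.
  difference : ∀ m n → (r m ℚ.* r n) ℚ.* (g n ℚ.- g m) ≡ r m ℚ.- r n
  difference m n = trans (lemma (r m) (r n) (g n) (g m))
    (trans (cong₂ (λ p q → r m ℚ.* p ℚ.- r n ℚ.* q) (gr≡1 n) (gr≡1 m))
           (cong₂ ℚ._-_ (ℚ.*-identityʳ (r m)) (ℚ.*-identityʳ (r n))))
    where
    open ℚS
    lemma : ∀ a b c d → (a ℚ.* b) ℚ.* (c ℚ.- d) ≡ a ℚ.* (c ℚ.* b) ℚ.- b ℚ.* (d ℚ.* a)
    lemma = solve 4 (λ a b c d → (a :* b) :* (c :- d) := a :* (c :* b) :- b :* (d :* a)) refl
  v : ℝ
  v = mkℝ r λ η 0<η →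
    let δ , 0<δ , κκδ≡η = divide (κ ℚ.* κ) η (*-pos 0<κ 0<κ) 0<η
        M , h = cauchy w δ 0<δ
    in N ⊔ M , λ m n le le′ → subst₂ (λ p q → ∣ p ∣ ℚ.< q) (difference m n) κκδ≡η
      (∣∣-*-bound {r m ℚ.* r n} {g n ℚ.- g m} (*-pos 0<κ 0<κ) (rr≤κκ m n)
        (subst₂ (λ p q → ∣ p ℚ.- q ∣ ℚ.< δ)
          (sym (g≡w n (ℕ.≤-trans (ℕ.m≤m⊔n N M) le′))) (sym (g≡w m (ℕ.≤-trans (ℕ.m≤m⊔n N M) le)))
          (h n m (ℕ.≤-trans (ℕ.m≤n⊔m N M) le′) (ℕ.≤-trans (ℕ.m≤n⊔m N M) le))))
  0<v : 0ℝ < v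
  -- An eventual upper bound K for `w` keeps the reciprocals above 1/K.
  0<v = let K , 0<K , M , w≤K = eventuallyBounded w
            κ′ , 0<κ′ , Kκ′≡1 = divide K 1ℚ 0<K (ℚ.positive⁻¹ 1ℚ)
    in eventually-0< v κ′ 0<κ′ (N ⊔ M) λ n le →
      reciprocal-antimono (0<r n) 0<κ′ (gr≡1 n) Kκ′≡1
        (subst (ℚ._≤ K) (sym (g≡w n (ℕ.≤-trans (ℕ.m≤m⊔n N M) le)))
          (ℚ.≤-trans (p≤∣p∣ (seq w n)) (w≤K n (ℕ.≤-trans (ℕ.m≤n⊔m N M) le))))

0<-* : ∀ x y → 0ℝ < x → 0ℝ < y → 0ℝ < x * y
0<-* x y 0<x 0<y with 0<-eventually x 0<x | 0<-eventually y 0<y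
... | ε , 0<ε , N , h | δ , 0<δ , M , g = eventually-0< (x * y) (ε ℚ.* δ) (*-pos 0<ε 0<δ) (N ⊔ M) λ n le →
  let ε≤x = h n (ℕ.≤-trans (ℕ.m≤m⊔n N M) le)
      δ≤y = g n (ℕ.≤-trans (ℕ.m≤n⊔m N M) le)
  in ℚ.≤-trans (ℚ.*-monoʳ-≤-nonNeg δ {{ℚ.nonNegative (ℚ.<⇒≤ 0<δ)}} ε≤x)
               (ℚ.*-monoˡ-≤-nonNeg (seq x n) {{ℚ.nonNegative (ℚ.≤-trans (ℚ.<⇒≤ 0<ε) ε≤x)}} δ≤y)

0<-difference : ∀ {x y} → x < y → 0ℝ < y - x
0<-difference {x} {y} (ε , 0<ε , N , h) = eventually-0< (y - x) ε 0<ε N λ n N≤n →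
  shift-≤ (h n N≤n) (lemma (seq x n) (seq y n) ε)
  where
  open ℚS
  lemma : ∀ x y e → y ℚ.- (x ℚ.+ e) ≡ (y ℚ.- x) ℚ.- e
  lemma = solve 3 (λ x y e → y :- (x :+ e) := (y :- x) :- e) refl

-- t is (z − y) / (z − x).
module _ (x y z t : ℝ) (N : ℕ)
  (t-spec : ∀ n → N ℕ.≤ n → seq t n ℚ.* (seq z n ℚ.- seq x n) ≡ seq z n ℚ.- seq y n) where

  combination : t * x + (1ℝ - t) * z ≈ y
  combination = ≈-eventually {t * x + (1ℝ - t) * z} {y} N λ n N≤n →
    trans (lemma (seq x n) (seq z n) (seq t n))
      (trans (cong (λ p → seq z n ℚ.- p) (t-spec n N≤n)) (lemma′ (seq y n) (seq z n)))
    where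
    open ℚS
    lemma : ∀ x z t → t ℚ.* x ℚ.+ (1ℚ ℚ.- t) ℚ.* z ≡ z ℚ.- t ℚ.* (z ℚ.- x)
    lemma = solve 3 (λ x z t → t :* x :+ (con 1ℚ :- t) :* z := z :- t :* (z :- x)) refl
    lemma′ : ∀ y z → z ℚ.- (z ℚ.- y) ≡ y
    lemma′ = solve 2 (λ y z → z :- (z :- y) := y) refl

  -- Reflection in the midpoint of x and z takes y to x + z - y and swaps the two weights.
  opposite-combination : t * z + (1ℝ - t) * x ≈ (x + z) - y
  opposite-combination = ≈-eventually {t * z + (1ℝ - t) * x} {(x + z) - y} N λ n N≤n →
    trans (lemma (seq x n) (seq z n) (seq t n))
      (trans (cong (seq x n ℚ.+_) (t-spec n N≤n)) (lemma′ (seq x n) (seq y n) (seq z n)))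
    where
    open ℚS
    lemma : ∀ x z t → t ℚ.* z ℚ.+ (1ℚ ℚ.- t) ℚ.* x ≡ x ℚ.+ t ℚ.* (z ℚ.- x)
    lemma = solve 3 (λ x z t → t :* z :+ (con 1ℚ :- t) :* x := x :+ t :* (z :- x)) refl
    lemma′ : ∀ x y z → x ℚ.+ (z ℚ.- y) ≡ (x ℚ.+ z) ℚ.- y
    lemma′ = solve 3 (λ x y z → x :+ (z :- y) := (x :+ z) :- y) refl

<1-complement : ∀ {t u} N → (∀ n → N ℕ.≤ n → seq t n ℚ.+ seq u n ≡ 1ℚ) → 0ℝ < u → t < 1ℝ
<1-complement {t} {u} N t+u≡1 0<u =
  let ε , 0<ε , M , ε≤u = 0<-eventually u 0<u
  in ε , 0<ε , N ⊔ M , λ n le → shift-≤ (ε≤u n (ℕ.≤-trans (ℕ.m≤n⊔m N M) le))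
    (trans (lemma (seq t n) (seq u n) ε)
      (cong (ℚ._- (seq t n ℚ.+ ε)) (t+u≡1 n (ℕ.≤-trans (ℕ.m≤m⊔n N M) le))))
  where
  open ℚS
  lemma : ∀ t u e → u ℚ.- e ≡ (t ℚ.+ u) ℚ.- (t ℚ.+ e)
  lemma = solve 3 (λ t u e → u :- e := (t :+ u) :- (t :+ e)) refl

-- The complement of t = (z - y) / (z - x) is (y - x) / (z - x), a product of positive reals just as
-- t is; this yields t < 1.
convexWeight : ∀ {x y z} → x < y → y < z →
  Σ[ t ∈ ℝ ] (0ℝ < t × t < 1ℝ ×
    ∃[ N ] (∀ n → N ℕ.≤ n → seq t n ℚ.* (seq z n ℚ.- seq x n) ≡ seq z n ℚ.- seq y n))
convexWeight {x} {y} {z} x<y y<z =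
  let v , 0<v , N , wv≡1 = reciprocal (z - x) (0<-difference {x} {z} (<-trans {x} {y} {z} x<y y<z))
  in (z - y) * v ,
     0<-* (z - y) v (0<-difference {y} {z} y<z) 0<v ,
     <1-complement {(z - y) * v} {(y - x) * v} N
       (λ n N≤n → trans (lemma (seq x n) (seq y n) (seq z n) (seq v n)) (wv≡1 n N≤n))
       (0<-* (y - x) v (0<-difference {x} {y} x<y) 0<v) ,
     N , λ n N≤n → trans (lemma′ (seq x n) (seq y n) (seq z n) (seq v n))
       (trans (cong ((seq z n ℚ.- seq y n) ℚ.*_) (wv≡1 n N≤n)) (ℚ.*-identityʳ (seq z n ℚ.- seq y n)))
  where
  open ℚS
  lemma : ∀ x y z v → (z ℚ.- y) ℚ.* v ℚ.+ (y ℚ.- x) ℚ.* v ≡ (z ℚ.- x) ℚ.* v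
  lemma = solve 4 (λ x y z v → (z :- y) :* v :+ (y :- x) :* v := (z :- x) :* v) refl
  lemma′ : ∀ x y z v → ((z ℚ.- y) ℚ.* v) ℚ.* (z ℚ.- x) ≡ (z ℚ.- y) ℚ.* ((z ℚ.- x) ℚ.* v)
  lemma′ = solve 4 (λ x y z v → ((z :- y) :* v) :* (z :- x) := (z :- y) :* ((z :- x) :* v)) refl

weighted-average-≤ : ∀ {a p q r} → 0ℚ ℚ.< a → 0ℚ ℚ.< 1ℚ ℚ.- a →
  r ℚ.≤ a ℚ.* p ℚ.+ (1ℚ ℚ.- a) ℚ.* q → r ℚ.≤ p ⊎ r ℚ.≤ q
weighted-average-≤ {a} {p} {q} {r} 0<a 0<1-a h with r ℚ.≤? p | r ℚ.≤? q
... | yes r≤p | _       = inj₁ r≤p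
... | no _    | yes r≤q = inj₂ r≤q
... | no r≰p  | no r≰q  = contradiction h
  (<⇒≱ (subst (a ℚ.* p ℚ.+ (1ℚ ℚ.- a) ℚ.* q ℚ.<_) (lemma a r)
    (ℚ.+-mono-< (ℚ.*-monoʳ-<-pos a {{ℚ.positive 0<a}} (ℚ.≰⇒> r≰p))
                (ℚ.*-monoʳ-<-pos (1ℚ ℚ.- a) {{ℚ.positive 0<1-a}} (ℚ.≰⇒> r≰q)))))
  where
  open ℚS
  lemma : ∀ a b → a ℚ.* b ℚ.+ (1ℚ ℚ.- a) ℚ.* b ≡ b
  lemma = solve 2 (λ a b → a :* b :+ (con 1ℚ :- a) :* b := b) refl

-- Which alternative holds cannot be decided from the reals themselves. It is decided by
-- `weighted-average-≤` at one rational index, and `locate` extends the gap found there to all later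
-- indices.
combination-bound : ∀ {t u v w} → 0ℝ < t → t < 1ℝ → w < t * u + (1ℝ - t) * v → w < u ⊎ w < v
combination-bound {t} {u} {v} {w} 0<t t<1 (ε , 0<ε , N , gap) =
  let τ , 0<τ , N₁ , τ≤t = 0<-eventually t 0<t
      τ′ , 0<τ′ , N₂ , τ′≤1-t = 0<-eventually (1ℝ - t) (0<-difference {t} {1ℝ} t<1)
      N₃ , w<u = locate w u ε 0<ε
      N₄ , w<v = locate w v ε 0<ε
      -- At this index the hypothesis has its gap, both weights are positive, and `locate` applies
      -- to u as well as to v.
      n = N ⊔ (N₁ ⊔ (N₂ ⊔ (N₃ ⊔ N₄)))
      n≥⊔₁ = ℕ.m≤n⊔m N (N₁ ⊔ (N₂ ⊔ (N₃ ⊔ N₄)))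
      n≥⊔₂ = ℕ.≤-trans (ℕ.m≤n⊔m N₁ (N₂ ⊔ (N₃ ⊔ N₄))) n≥⊔₁
      n≥⊔₃ = ℕ.≤-trans (ℕ.m≤n⊔m N₂ (N₃ ⊔ N₄)) n≥⊔₂
  in [ (λ h → inj₁ (w<u n (ℕ.≤-trans (ℕ.m≤m⊔n N₃ N₄) n≥⊔₃) h))
     , (λ h → inj₂ (w<v n (ℕ.≤-trans (ℕ.m≤n⊔m N₃ N₄) n≥⊔₃) h)) ]′
     (weighted-average-≤
       (ℚ.<-≤-trans 0<τ (τ≤t n (ℕ.≤-trans (ℕ.m≤m⊔n N₁ (N₂ ⊔ (N₃ ⊔ N₄))) n≥⊔₁)))
       (ℚ.<-≤-trans 0<τ′ (τ′≤1-t n (ℕ.≤-trans (ℕ.m≤m⊔n N₂ (N₃ ⊔ N₄)) n≥⊔₂)))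
       (gap n (ℕ.m≤m⊔n N (N₁ ⊔ (N₂ ⊔ (N₃ ⊔ N₄))))))

-- Consequences of strict convexity.

module _ (F : Func ℝ-setoid ℝ-setoid) (convex : StrictlyConvex F) where

  convex-at : ∀ {x y z t} → x # z → 0ℝ < t → t < 1ℝ → t * x + (1ℝ - t) * z ≈ y →
    F ⟨$⟩ y < t * (F ⟨$⟩ x) + (1ℝ - t) * (F ⟨$⟩ z)
  convex-at {x} {y} {z} {t} x#z 0<t t<1 mid =
    <-respˡ-≈ {F ⟨$⟩ (t * x + (1ℝ - t) * z)} {F ⟨$⟩ y} {t * (F ⟨$⟩ x) + (1ℝ - t) * (F ⟨$⟩ z)}
      (Func.cong F {t * x + (1ℝ - t) * z} {y} mid) (convex x z t x#z 0<t t<1)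

  -- F y lies strictly below a weighted average of F x and F z. This disjunction is the only form of
  -- convexity needed to find a piece on which F is monotone.
  below-endpoint : ∀ {x y z} → x < y → y < z → F ⟨$⟩ y < F ⟨$⟩ x ⊎ F ⟨$⟩ y < F ⟨$⟩ z
  below-endpoint {x} {y} {z} x<y y<z =
    let t , 0<t , t<1 , N , t-spec = convexWeight {x} {y} {z} x<y y<z
    in weighted t 0<t t<1 (combination x y z t N t-spec)
    where
    weighted : ∀ t → 0ℝ < t → t < 1ℝ → t * x + (1ℝ - t) * z ≈ y → F ⟨$⟩ y < F ⟨$⟩ x ⊎ F ⟨$⟩ y < F ⟨$⟩ z
    weighted t 0<t t<1 mid = combination-bound {t} {F ⟨$⟩ x} {F ⟨$⟩ z} {F ⟨$⟩ y} 0<t t<1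
      (convex-at {x} {y} {z} {t} (inj₁ (<-trans {x} {y} {z} x<y y<z)) 0<t t<1 mid)

  -- Both inner points are convex combinations of x and y′, with complementary weights.
  increasing-increments : ∀ {x y x′ y′} → x < x′ → x′ < y′ → x + y′ ≈ x′ + y →
    (F ⟨$⟩ x′) + (F ⟨$⟩ y) < (F ⟨$⟩ x) + (F ⟨$⟩ y′)
  increasing-increments {x} {y} {x′} {y′} x<x′ x′<y′ eq =
    let t , 0<t , t<1 , N , t-spec = convexWeight {x} {x′} {y′} x<x′ x′<y′
    in weighted t 0<t t<1 (combination x x′ y′ t N t-spec) (opposite-combination x x′ y′ t N t-spec)
    where
    x<y′ : x < y′
    x<y′ = <-trans {x} {x′} {y′} x<x′ x′<y′
    open ℚS
    lemma : ∀ t p q → (t ℚ.* p ℚ.+ (1ℚ ℚ.- t) ℚ.* q) ℚ.+ (t ℚ.* q ℚ.+ (1ℚ ℚ.- t) ℚ.* p) ≡ p ℚ.+ q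
    lemma = solve 3 (λ t p q → (t :* p :+ (con 1ℚ :- t) :* q) :+ (t :* q :+ (con 1ℚ :- t) :* p) := p :+ q) refl
    lemma′ : ∀ x y x′ y′ → ((x ℚ.+ y′) ℚ.- x′) ℚ.- y ≡ (x ℚ.+ y′) ℚ.- (x′ ℚ.+ y)
    lemma′ = solve 4 (λ x y x′ y′ → ((x :+ y′) :- x′) :- y := (x :+ y′) :- (x′ :+ y)) refl
    y≈ : (x + y′) - x′ ≈ y
    y≈ = ≈-diff {(x + y′) - x′} {y} {x + y′} {x′ + y}
      (λ n → lemma′ (seq x n) (seq y n) (seq x′ n) (seq y′ n)) eq
    -- The weights of p in the two combinations add up to 1, and so do those of q, hence t drops out
    -- of the sum.
    cancel : ∀ t p q → (t * p + (1ℝ - t) * q) + (t * q + (1ℝ - t) * p) ≈ p + q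
    cancel t p q = ≈-eventually {(t * p + (1ℝ - t) * q) + (t * q + (1ℝ - t) * p)} {p + q} 0
      λ n _ → lemma (seq t n) (seq p n) (seq q n)
    sum : ∀ t p q {r s} → r < t * p + (1ℝ - t) * q → s < t * q + (1ℝ - t) * p → r + s < p + q
    sum t p q {r} {s} h h′ =
      <-respʳ-≈ {r + s} {(t * p + (1ℝ - t) * q) + (t * q + (1ℝ - t) * p)} {p + q} (cancel t p q)
        (+-mono-< {r} {t * p + (1ℝ - t) * q} {s} {t * q + (1ℝ - t) * p} h h′)
    weighted : ∀ t → 0ℝ < t → t < 1ℝ → t * x + (1ℝ - t) * y′ ≈ x′ → t * y′ + (1ℝ - t) * x ≈ (x + y′) - x′ →
      (F ⟨$⟩ x′) + (F ⟨$⟩ y) < (F ⟨$⟩ x) + (F ⟨$⟩ y′)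
    weighted t 0<t t<1 mid mid′ = sum t (F ⟨$⟩ x) (F ⟨$⟩ y′) {F ⟨$⟩ x′} {F ⟨$⟩ y}
      (convex-at {x} {x′} {y′} {t} (inj₁ x<y′) 0<t t<1 mid)
      (convex-at {y′} {y} {x} {t} (inj₂ x<y′) 0<t t<1
        (≈-trans {t * y′ + (1ℝ - t) * x} {(x + y′) - x′} {y} mid′ y≈))

-- Counting short steps

-- A step is short if `u` rises by at most D and `v` by at most E. Short steps are listed by an
-- injection; long ones are only counted, each being charged to a sequence that rises by at least D
-- + 1 or E + 1 there. Their number is then limited by the total rise, written additively to avoid
-- truncated subtraction.
record ShortGaps {K} (u v : Fin (suc K) → ℕ) (D E : ℕ) : Set where
  field
    short longᵤ longᵥ : ℕ
    gap           : Fin short → Fin K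
    gap-injective : Injective _≡_ _≡_ gap
    gapᵤ          : ∀ x → u (suc (gap x)) ℕ.≤ u (inject₁ (gap x)) ℕ.+ D
    gapᵥ          : ∀ x → v (suc (gap x)) ℕ.≤ v (inject₁ (gap x)) ℕ.+ E
    longᵤ-bound   : u zero ℕ.+ longᵤ ℕ.* suc D ℕ.≤ u (Fin.fromℕ K)
    longᵥ-bound   : v zero ℕ.+ longᵥ ℕ.* suc E ℕ.≤ v (Fin.fromℕ K)
    total         : K ℕ.≤ short ℕ.+ (longᵤ ℕ.+ longᵥ)

long-step : ∀ {a b c} l D → ¬ (b ℕ.≤ a ℕ.+ D) → b ℕ.+ l ℕ.* suc D ℕ.≤ c → a ℕ.+ suc l ℕ.* suc D ℕ.≤ c
long-step {a} {b} {c} l D b≰a+D h = begin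
  a ℕ.+ suc l ℕ.* suc D          ≡⟨ lemma a l D ⟩
  suc (a ℕ.+ D) ℕ.+ l ℕ.* suc D  ≤⟨ ℕ.+-monoˡ-≤ (l ℕ.* suc D) (ℕ.≰⇒> b≰a+D) ⟩
  b ℕ.+ l ℕ.* suc D              ≤⟨ h ⟩
  c                              ∎
  where
  open ℕ.≤-Reasoning
  open +-*-Solver
  lemma : ∀ a l D → a ℕ.+ suc l ℕ.* suc D ≡ suc (a ℕ.+ D) ℕ.+ l ℕ.* suc D
  lemma = solve 3 (λ a l D → a :+ (con 1 :+ l) :* (con 1 :+ D) := (con 1 :+ (a :+ D)) :+ l :* (con 1 :+ D)) refl

shortGaps : ∀ K (u v : Fin (suc K) → ℕ) D E →
  (∀ i → u (inject₁ i) ℕ.≤ u (suc i)) → (∀ i → v (inject₁ i) ℕ.≤ v (suc i)) → ShortGaps u v D E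
shortGaps zero u v D E _ _ = record
  { short = 0 ; longᵤ = 0 ; longᵥ = 0
  ; gap = λ () ; gap-injective = λ { {()} } ; gapᵤ = λ () ; gapᵥ = λ ()
  ; longᵤ-bound = ℕ.≤-reflexive (ℕ.+-identityʳ _)
  ; longᵥ-bound = ℕ.≤-reflexive (ℕ.+-identityʳ _)
  ; total = z≤n }
shortGaps (suc K) u v D E u-mono v-mono
  with shortGaps K (u ∘ suc) (v ∘ suc) D E (u-mono ∘ suc) (v-mono ∘ suc)
     | u (suc zero) ℕ.≤? u zero ℕ.+ D | v (suc zero) ℕ.≤? v zero ℕ.+ E
-- A step that is long for both sequences is charged to `u` alone.
... | r | no u≰ | _ = record
  { short = short ; longᵤ = suc longᵤ ; longᵥ = longᵥ
  ; gap = suc ∘ gap ; gap-injective = gap-injective ∘ Fin.suc-injective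
  ; gapᵤ = gapᵤ ; gapᵥ = gapᵥ
  ; longᵤ-bound = long-step longᵤ D u≰ longᵤ-bound
  ; longᵥ-bound = ℕ.≤-trans (ℕ.+-monoˡ-≤ _ (v-mono zero)) longᵥ-bound
  ; total = ℕ.≤-trans (ℕ.s≤s total) (ℕ.≤-reflexive (sym (ℕ.+-suc short (longᵤ ℕ.+ longᵥ)))) }
  where open ShortGaps r
... | r | yes _ | no v≰ = record
  { short = short ; longᵤ = longᵤ ; longᵥ = suc longᵥ
  ; gap = suc ∘ gap ; gap-injective = gap-injective ∘ Fin.suc-injective
  ; gapᵤ = gapᵤ ; gapᵥ = gapᵥ
  ; longᵤ-bound = ℕ.≤-trans (ℕ.+-monoˡ-≤ _ (u-mono zero)) longᵤ-bound
  ; longᵥ-bound = long-step longᵥ E v≰ longᵥ-bound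
  ; total = ℕ.≤-trans (ℕ.s≤s total) (ℕ.≤-reflexive (sym
      (trans (cong (short ℕ.+_) (ℕ.+-suc longᵤ longᵥ)) (ℕ.+-suc short (longᵤ ℕ.+ longᵥ))))) }
  where open ShortGaps r
... | r | yes u≤ | yes v≤ = record
  { short = suc short ; longᵤ = longᵤ ; longᵥ = longᵥ
  ; gap = gap′ ; gap-injective = gap′-injective
  ; gapᵤ = λ { zero → u≤ ; (suc x) → gapᵤ x }
  ; gapᵥ = λ { zero → v≤ ; (suc x) → gapᵥ x }
  ; longᵤ-bound = ℕ.≤-trans (ℕ.+-monoˡ-≤ _ (u-mono zero)) longᵤ-bound
  ; longᵥ-bound = ℕ.≤-trans (ℕ.+-monoˡ-≤ _ (v-mono zero)) longᵥ-bound
  ; total = ℕ.s≤s total }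
  where
  open ShortGaps r
  gap′ : Fin (suc short) → Fin (suc K)
  gap′ zero    = zero
  gap′ (suc x) = suc (gap x)
  gap′-injective : Injective _≡_ _≡_ gap′
  gap′-injective {zero}  {zero}  _  = refl
  gap′-injective {suc x} {suc y} eq = cong suc (gap-injective (Fin.suc-injective eq))

m<[1+m/n]*n : ∀ m n .{{_ : NonZero n}} → m ℕ.< suc (m ℕ./ n) ℕ.* n
m<[1+m/n]*n m n = begin-strict
  m                              ≡⟨ m≡m%n+[m/n]*n m n ⟩
  m ℕ.% n ℕ.+ (m ℕ./ n) ℕ.* n    <⟨ ℕ.+-monoˡ-< _ (m%n<n m n) ⟩
  n ℕ.+ (m ℕ./ n) ℕ.* n          ∎
  where open ℕ.≤-Reasoning

-- The l long steps fit below m and each exceeds 4m/K, so 4lm ≤ Km. Here m can be cancelled, as x <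
-- m makes it positive.
long-few : ∀ {a x} l m K .{{_ : NonZero K}} → x ℕ.< m → a ℕ.+ l ℕ.* suc (4 ℕ.* m ℕ./ K) ℕ.≤ x → 4 ℕ.* l ℕ.≤ K
long-few {a} {x} l m@(suc _) K x<m h = ℕ.*-cancelʳ-≤ (4 ℕ.* l) K m (begin
  4 ℕ.* l ℕ.* m                        ≡⟨ lemma l m ⟩
  l ℕ.* (4 ℕ.* m)                      ≤⟨ ℕ.*-monoʳ-≤ l (ℕ.<⇒≤ (m<[1+m/n]*n (4 ℕ.* m) K)) ⟩
  l ℕ.* (suc (4 ℕ.* m ℕ./ K) ℕ.* K)    ≡⟨ ℕ.*-assoc l _ K ⟨
  l ℕ.* suc (4 ℕ.* m ℕ./ K) ℕ.* K      ≤⟨ ℕ.*-monoˡ-≤ K (ℕ.≤-trans (ℕ.m≤n+m _ a) (ℕ.≤-trans h (ℕ.<⇒≤ x<m))) ⟩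
  m ℕ.* K                              ≡⟨ ℕ.*-comm m K ⟩
  K ℕ.* m                              ∎)
  where
  open ℕ.≤-Reasoning
  open +-*-Solver
  lemma : ∀ l m → 4 ℕ.* l ℕ.* m ≡ l ℕ.* (4 ℕ.* m)
  lemma = solve 2 (λ l m → con 4 :* l :* m := l :* (con 4 :* m)) refl

-- At most K/4 steps are long for either sequence, so K ≤ 2h; as h is an integer, it reaches the
-- ceiling of K/2.
half-short : ∀ {K} h b b′ → K ℕ.≤ h ℕ.+ (b ℕ.+ b′) → 4 ℕ.* b ℕ.≤ K → 4 ℕ.* b′ ℕ.≤ K → ⌈ K /2⌉ ℕ.≤ h
half-short {K} h b b′ total 4b≤K 4b′≤K = subst (⌈ K /2⌉ ℕ.≤_) (sym (ℕ.n≡⌈n+n/2⌉ h)) (ℕ.⌈n/2⌉-mono K≤h+h)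
  where
  open +-*-Solver
  K≤h+h : K ℕ.≤ h ℕ.+ h
  K≤h+h = ℕ.*-cancelˡ-≤ 2 (ℕ.+-cancelʳ-≤ (2 ℕ.* K) _ _ (begin
    2 ℕ.* K ℕ.+ 2 ℕ.* K                      ≡⟨ solve 1 (λ K → con 2 :* K :+ con 2 :* K := con 4 :* K) refl K ⟩
    4 ℕ.* K                                  ≤⟨ ℕ.*-monoʳ-≤ 4 total ⟩
    4 ℕ.* (h ℕ.+ (b ℕ.+ b′))                 ≡⟨ solve 3 (λ h b b′ → con 4 :* (h :+ (b :+ b′)) := con 2 :* (h :+ h) :+ (con 4 :* b :+ con 4 :* b′)) refl h b b′ ⟩
    2 ℕ.* (h ℕ.+ h) ℕ.+ (4 ℕ.* b ℕ.+ 4 ℕ.* b′)  ≤⟨ ℕ.+-monoʳ-≤ (2 ℕ.* (h ℕ.+ h)) (ℕ.+-mono-≤ 4b≤K 4b′≤K) ⟩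
    2 ℕ.* (h ℕ.+ h) ℕ.+ (K ℕ.+ K)            ≡⟨ cong (2 ℕ.* (h ℕ.+ h) ℕ.+_) (cong (K ℕ.+_) (sym (ℕ.+-identityʳ K))) ⟩
    2 ℕ.* (h ℕ.+ h) ℕ.+ 2 ℕ.* K              ∎))
    where open ℕ.≤-Reasoning

-- Encoding short steps by their end points.

↔-injective⇒≤ : ∀ {A B : Set} {m n} → Fin m ↔ A → Fin n ↔ B → (f : A → B) → Injective _≡_ _≡_ f → m ℕ.≤ n
↔-injective⇒≤ a b f f-inj =
  Fin.injective⇒≤ (Injection.injective (↔⇒↣ (↔-sym b) ↣-∘ (mk↣ f-inj ↣-∘ ↔⇒↣ a)))

-- Strict increase leaves the offset b - a - 1 only D values, so a start among m labels and an
-- offset make up m D codes.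
gapCode : ∀ {a b} D → a ℕ.< b → b ℕ.≤ a ℕ.+ D → Σ[ d ∈ Fin D ] suc a ℕ.+ toℕ d ≡ b
gapCode {a} {b} D a<b b≤a+D = fromℕ< d<D , trans (cong (suc a ℕ.+_) (Fin.toℕ-fromℕ< d<D)) (ℕ.m+[n∸m]≡n a<b)
  where
  d<D : b ℕ.∸ suc a ℕ.< D
  d<D = ℕ.+-cancelˡ-≤ a _ _ (subst (ℕ._≤ a ℕ.+ D) (sym (trans (ℕ.+-suc a _) (ℕ.m+[n∸m]≡n a<b))) b≤a+D)

-- The counting sees only labels: `u i j` and `v i q` stand for the ranks of the i-th point after
-- translation by the j-th and q-th shift. Convexity enters through `determined` alone.
module _ (K l p m n : ℕ) (u : Fin (suc K) → Fin l → Fin m) (v : Fin (suc K) → Fin p → Fin n)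
  (u-mono : ∀ i j → u (inject₁ i) j Fin.< u (suc i) j)
  (v-mono : ∀ i q → v (inject₁ i) q Fin.< v (suc i) q)
  (determined : ∀ i i′ j j′ q q′ →
    u (inject₁ i) j ≡ u (inject₁ i′) j′ → u (suc i) j ≡ u (suc i′) j′ →
    v (inject₁ i) q ≡ v (inject₁ i′) q′ → v (suc i) q ≡ v (suc i′) q′ →
    i ≡ i′ × j ≡ j′ × q ≡ q′) where

  -- For each pair of translates, ⌈K/2⌉ short steps are encoded by their starting labels and
  -- offsets. The code gives back both end labels, hence the step and the translates by
  -- `determined`; injectivity of `gap` then gives back the position in the list.
  short-pairs : .{{_ : NonZero K}} →
    ⌈ K /2⌉ ℕ.* (l ℕ.* p) ℕ.≤ (m ℕ.* (4 ℕ.* m ℕ./ K)) ℕ.* (n ℕ.* (4 ℕ.* n ℕ./ K))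
  short-pairs = ↔-injective⇒≤
    ((↔-id _ ×-↔ Fin.*↔×) ↔-∘ Fin.*↔×) ((Fin.*↔× ×-↔ Fin.*↔×) ↔-∘ Fin.*↔×) code code-injective
    where
    D = 4 ℕ.* m ℕ./ K
    E = 4 ℕ.* n ℕ./ K
    gaps : ∀ j q → ShortGaps (λ i → toℕ (u i j)) (λ i → toℕ (v i q)) D E
    gaps j q = shortGaps K _ _ D E (λ i → ℕ.<⇒≤ (u-mono i j)) (λ i → ℕ.<⇒≤ (v-mono i q))
    enough : ∀ j q → ⌈ K /2⌉ ℕ.≤ ShortGaps.short (gaps j q)
    enough j q = half-short short longᵤ longᵥ total
      (long-few {toℕ (u zero j)} longᵤ m K (Fin.toℕ<n (u (Fin.fromℕ K) j)) longᵤ-bound)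
      (long-few {toℕ (v zero q)} longᵥ n K (Fin.toℕ<n (v (Fin.fromℕ K) q)) longᵥ-bound)
      where open ShortGaps (gaps j q)
    index : Fin ⌈ K /2⌉ → Fin l → Fin p → Fin K
    index x j q = ShortGaps.gap (gaps j q) (inject≤ x (enough j q))
    codeᵤ : ∀ x j q → let i = index x j q in Σ[ d ∈ Fin D ] suc (toℕ (u (inject₁ i) j)) ℕ.+ toℕ d ≡ toℕ (u (suc i) j)
    codeᵤ x j q = gapCode D (u-mono (index x j q) j) (ShortGaps.gapᵤ (gaps j q) _)
    codeᵥ : ∀ x j q → let i = index x j q in Σ[ d ∈ Fin E ] suc (toℕ (v (inject₁ i) q)) ℕ.+ toℕ d ≡ toℕ (v (suc i) q)
    codeᵥ x j q = gapCode E (v-mono (index x j q) q) (ShortGaps.gapᵥ (gaps j q) _)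
    code : Fin ⌈ K /2⌉ × (Fin l × Fin p) → (Fin m × Fin D) × (Fin n × Fin E)
    code (x , j , q) =
      (u (inject₁ (index x j q)) j , proj₁ (codeᵤ x j q)) ,
      (v (inject₁ (index x j q)) q , proj₁ (codeᵥ x j q))
    next : ∀ {k d} {a a′ b b′ : Fin k} {c c′ : Fin d} →
      suc (toℕ a) ℕ.+ toℕ c ≡ toℕ b → suc (toℕ a′) ℕ.+ toℕ c′ ≡ toℕ b′ → a ≡ a′ → c ≡ c′ → b ≡ b′
    next e e′ refl refl = Fin.toℕ-injective (trans (sym e) e′)
    code-injective : Injective _≡_ _≡_ code
    code-injective {x , j , q} {x′ , j′ , q′} eq =
      let eqᵤ , eqᵥ = ,-injective eq
          u≡ , d≡ = ,-injective eqᵤ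
          v≡ , e≡ = ,-injective eqᵥ
      in conclude (determined (index x j q) (index x′ j′ q′) j j′ q q′
           u≡ (next (proj₂ (codeᵤ x j q)) (proj₂ (codeᵤ x′ j′ q′)) u≡ d≡)
           v≡ (next (proj₂ (codeᵥ x j q)) (proj₂ (codeᵥ x′ j′ q′)) v≡ e≡))
      where
      conclude : index x j q ≡ index x′ j′ q′ × j ≡ j′ × q ≡ q′ → (x , j , q) ≡ (x′ , j′ , q′)
      conclude (i≡ , refl , refl) = cong (_, j , q)
        (Fin.inject≤-injective (enough j q) (enough j q) x x′ (ShortGaps.gap-injective (gaps j q) i≡))

  -- Two factors K clear the divisions, as ⌊4m/K⌋ K ≤ 4m, and the third is at most 2⌈K/2⌉; so 32 = 2
  -- · 4 · 4.
  gap-count-nonZero : .{{_ : NonZero K}} → K ℕ.* K ℕ.* K ℕ.* (l ℕ.* p) ℕ.≤ 32 ℕ.* (m ℕ.* m ℕ.* (n ℕ.* n))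
  gap-count-nonZero = begin
    K ℕ.* K ℕ.* K ℕ.* (l ℕ.* p)
      ≤⟨ ℕ.*-monoˡ-≤ (l ℕ.* p) (ℕ.*-monoʳ-≤ (K ℕ.* K) K≤h+h) ⟩
    K ℕ.* K ℕ.* (h ℕ.+ h) ℕ.* (l ℕ.* p)
      ≡⟨ solve 3 (λ K h c → K :* K :* (h :+ h) :* c := con 2 :* (K :* K) :* (h :* c)) refl K h (l ℕ.* p) ⟩
    2 ℕ.* (K ℕ.* K) ℕ.* (h ℕ.* (l ℕ.* p))
      ≤⟨ ℕ.*-monoʳ-≤ (2 ℕ.* (K ℕ.* K)) short-pairs ⟩
    2 ℕ.* (K ℕ.* K) ℕ.* ((m ℕ.* D) ℕ.* (n ℕ.* E))
      ≡⟨ solve 5 (λ K m n D E → con 2 :* (K :* K) :* ((m :* D) :* (n :* E)) := con 2 :* (m :* n) :* ((D :* K) :* (E :* K))) refl K m n D E ⟩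
    2 ℕ.* (m ℕ.* n) ℕ.* ((D ℕ.* K) ℕ.* (E ℕ.* K))
      ≤⟨ ℕ.*-monoʳ-≤ (2 ℕ.* (m ℕ.* n)) (ℕ.*-mono-≤ (m/n*n≤m (4 ℕ.* m) K) (m/n*n≤m (4 ℕ.* n) K)) ⟩
    2 ℕ.* (m ℕ.* n) ℕ.* ((4 ℕ.* m) ℕ.* (4 ℕ.* n))
      ≡⟨ solve 2 (λ m n → con 2 :* (m :* n) :* ((con 4 :* m) :* (con 4 :* n)) := con 32 :* (m :* m :* (n :* n))) refl m n ⟩
    32 ℕ.* (m ℕ.* m ℕ.* (n ℕ.* n)) ∎
    where
    open ℕ.≤-Reasoning
    open +-*-Solver
    h = ⌈ K /2⌉
    D = 4 ℕ.* m ℕ./ K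
    E = 4 ℕ.* n ℕ./ K
    K≤h+h : K ℕ.≤ h ℕ.+ h
    K≤h+h = subst (ℕ._≤ h ℕ.+ h) (ℕ.⌊n/2⌋+⌈n/2⌉≡n K) (ℕ.+-monoˡ-≤ h (ℕ.⌊n/2⌋≤⌈n/2⌉ K))

  gap-count : K ℕ.* K ℕ.* K ℕ.* (l ℕ.* p) ℕ.≤ 32 ℕ.* (m ℕ.* m ℕ.* (n ℕ.* n))
  gap-count with K ℕ.≟ 0
  ... | yes K≡0 = subst (λ k → k ℕ.* k ℕ.* k ℕ.* (l ℕ.* p) ℕ.≤ 32 ℕ.* (m ℕ.* m ℕ.* (n ℕ.* n))) (sym K≡0) z≤n
  ... | no K≢0  = gap-count-nonZero {{ℕ.≢-nonZero K≢0}}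

-- Finite families of reals

Trichotomous : ∀ {n} → (Fin n → ℝ) → Set
Trichotomous f = ∀ i j → f i < f j ⊎ f i ≈ f j ⊎ f j < f i

-- Refuting both strict inequalities already proves the middle alternative, by `≮-antisym`.
¬¬-compare : ∀ x y → ¬ ¬ (x < y ⊎ x ≈ y ⊎ y < x)
¬¬-compare x y h = h (inj₂ (inj₁ (≮-antisym {x} {y} (h ∘ inj₁) (h ∘ inj₂ ∘ inj₂))))

-- Double negation commutes with finite conjunctions, so all comparisons may be assumed at once.
¬¬-trichotomous : ∀ {n} (f : Fin n → ℝ) → ¬ ¬ Trichotomous f
¬¬-trichotomous f = sequence λ i → sequence λ j → ¬¬-compare (f i) (f j)
  where sequence = Fin.sequence (RawMonad.rawApplicative ¬¬-Monad)

-- A missed value could be punched out, giving an injection from `Fin (suc n)` to `Fin n`.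
injective⇒surjective : ∀ {n} {f : Fin n → Fin n} → Injective _≡_ _≡_ f → ∀ y → ∃[ x ] f x ≡ y
injective⇒surjective {suc n} {f} f-inj y with Fin.any? (λ x → f x Fin.≟ y)
... | yes x∈ = x∈
... | no ∄x  = contradiction
  (Fin.injective⇒≤ {f = λ x → punchOut {i = y} {j = f x} (y≢f x)}
    λ {x} {x′} eq → f-inj (Fin.punchOut-injective (y≢f x) (y≢f x′) eq))
  ℕ.1+n≰n
  where
  y≢f : ∀ x → y ≢ f x
  y≢f x y≡fx = ∄x (x , sym y≡fx)

-- Ranks and sorting.

module _ {n} (f : Fin n → ℝ) (cmp : Trichotomous f) where

  less? : ∀ i j → Dec (f i < f j)
  less? i j with cmp i j
  ... | inj₁ lt        = yes lt
  ... | inj₂ (inj₁ eq) = no (≈⇒≮ {f i} {f j} eq)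
  ... | inj₂ (inj₂ gt) = no (<-asym {f j} {f i} gt)

  below : Fin n → Subset n
  below i = tabulate λ j → does (less? j i)

  ∈below⁺ : ∀ {i j} → f j < f i → j ∈ below i
  ∈below⁺ {i} {j} lt = lookup⇒[]= j (below i) (trans (lookup∘tabulate _ j) (dec-true (less? j i) lt))

  ∈below⁻ : ∀ {i j} → j ∈ below i → f j < f i
  ∈below⁻ {i} {j} j∈ with less? j i | trans (sym (lookup∘tabulate (λ j → does (less? j i)) j)) ([]=⇒lookup j∈)
  ... | yes lt | _ = lt

  i∉below : ∀ i → i ∉ below i
  i∉below i = <-irrefl {f i} ∘ ∈below⁻

  ∣below∣<n : ∀ i → Subset.∣ below i ∣ ℕ.< n
  ∣below∣<n i = subst (Subset.∣ below i ∣ ℕ.<_) (∣⊤∣≡n n) (p⊂q⇒∣p∣<∣q∣ ((λ _ → ∈⊤) , i , ∈⊤ , i∉below i))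

  rank : Fin n → Fin n
  rank i = fromℕ< (∣below∣<n i)

  -- Everything below `f i` is below `f j`, and i itself witnesses that the inclusion is proper.
  rank-mono : ∀ {i j} → f i < f j → rank i Fin.< rank j
  rank-mono {i} {j} lt = subst₂ ℕ._<_ (sym (Fin.toℕ-fromℕ< (∣below∣<n i))) (sym (Fin.toℕ-fromℕ< (∣below∣<n j)))
    (p⊂q⇒∣p∣<∣q∣ ((λ {x} x∈ → ∈below⁺ (<-trans {f x} {f i} {f j} (∈below⁻ x∈) lt)) , i , ∈below⁺ lt , i∉below i))

  rank-≈ : ∀ {i j} → rank i ≡ rank j → f i ≈ f j
  rank-≈ {i} {j} eq =
    [ (λ lt → contradiction eq (Fin.<⇒≢ (rank-mono {i} {j} lt)))
    , [ (λ f≈ → f≈) , (λ gt → contradiction (sym eq) (Fin.<⇒≢ (rank-mono {j} {i} gt))) ]′ ]′ (cmp i j)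

  -- Without repetitions `rank` is injective on a finite set, hence a bijection, and its inverse
  -- lists the indices in increasing order of value.
  sorting : Injective _≡_ _≈_ f → Σ[ σ ∈ (Fin n → Fin n) ] (∀ i j → i Fin.< j → f (σ i) < f (σ j))
  sorting f-inj = σ , σ-mono
    where
    rank⁻¹ : ∀ i → ∃[ j ] rank j ≡ i
    rank⁻¹ = injective⇒surjective {f = rank} λ {i} {j} eq → f-inj {i} {j} (rank-≈ {i} {j} eq)
    σ : Fin n → Fin n
    σ i = proj₁ (rank⁻¹ i)
    rank-σ : ∀ i → rank (σ i) ≡ i
    rank-σ i = proj₂ (rank⁻¹ i)
    σ-mono : ∀ i j → i Fin.< j → f (σ i) < f (σ j)
    σ-mono i j i<j =
      [ (λ lt → lt)
      , [ (λ f≈ → contradiction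
            (trans (sym (rank-σ i)) (trans (cong rank (f-inj {σ i} {σ j} f≈)) (rank-σ j))) (Fin.<⇒≢ i<j))
        , (λ gt → contradiction
            (subst₂ Fin._<_ (rank-σ j) (rank-σ i) (rank-mono {σ j} {σ i} gt)) (Fin.<-asym i<j)) ]′ ]′ (cmp (σ i) (σ j))

Increasing Decreasing : ∀ {n} → (Fin n → ℝ) → Set
Increasing f = ∀ i j → i Fin.< j → f i < f j
Decreasing f = ∀ i j → i Fin.< j → f j < f i

increasing⇒injective : ∀ {n} {f : Fin n → ℝ} → Increasing f → Injective _≡_ _≈_ f
increasing⇒injective {f = f} inc {i} {j} eq with Fin.<-cmp i j
... | tri< i<j _ _  = contradiction (inc i j i<j) (≈⇒≮ {f i} {f j} eq)
... | tri≈ _ i≡j _  = i≡j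
... | tri> _ _ j<i  = contradiction (inc j i j<i) (≈⇒≮ {f j} {f i} (≈-sym {f i} {f j} eq))

decreasing⇒injective : ∀ {n} {f : Fin n → ℝ} → Decreasing f → Injective _≡_ _≈_ f
decreasing⇒injective {f = f} dec {i} {j} eq with Fin.<-cmp i j
... | tri< i<j _ _  = contradiction (dec i j i<j) (≈⇒≮ {f j} {f i} (≈-sym {f i} {f j} eq))
... | tri≈ _ i≡j _  = i≡j
... | tri> _ _ j<i  = contradiction (dec j i j<i) (≈⇒≮ {f i} {f j} eq)

opposite-anti : ∀ {n} {i j : Fin n} → i Fin.< j → opposite j Fin.< opposite i
opposite-anti {n} {i} {j} i<j = subst₂ ℕ._<_ (sym (Fin.opposite-prop j)) (sym (Fin.opposite-prop i))
  (ℕ.∸-monoʳ-< (ℕ.s<s i<j) (Fin.toℕ<n j))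

opposite-injective : ∀ {n} {i j : Fin n} → opposite i ≡ opposite j → i ≡ j
opposite-injective {i = i} {j} eq = trans (sym (Fin.opposite-involutive i)) (trans (cong opposite eq) (Fin.opposite-involutive j))

-- Monotone pieces and the inequality for labelled sums.

module _ (F : Func ℝ-setoid ℝ-setoid) (convex : StrictlyConvex F) where

  -- On q, x, y the alternative is F x < F q. But on p, q, x the value F q lies below F p, which is
  -- excluded, or below F x.
  increasing-right : ∀ {p q x y} → p < q → q < x → x < y → ¬ (F ⟨$⟩ q < F ⟨$⟩ p) → F ⟨$⟩ x < F ⟨$⟩ y
  increasing-right {p} {q} {x} {y} p<q q<x x<y Fq≮Fp =
    [ (λ Fx<Fq → contradiction
        ([ (λ Fq<Fp → contradiction Fq<Fp Fq≮Fp) , (λ h → h) ]′ (below-endpoint F convex {p} {q} {x} p<q q<x))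
        (<-asym {F ⟨$⟩ x} {F ⟨$⟩ q} Fx<Fq))
    , (λ h → h) ]′ (below-endpoint F convex {q} {x} {y} q<x x<y)

  -- The mirror image of `increasing-right`.
  decreasing-left : ∀ {x y p q} → x < y → y < p → p < q → ¬ (F ⟨$⟩ p < F ⟨$⟩ q) → F ⟨$⟩ y < F ⟨$⟩ x
  decreasing-left {x} {y} {p} {q} x<y y<p p<q Fp≮Fq =
    [ (λ h → h)
    , (λ Fy<Fp → contradiction
        ([ (λ h → h) , (λ Fp<Fq → contradiction Fp<Fq Fp≮Fq) ]′ (below-endpoint F convex {y} {p} {q} y<p p<q))
        (<-asym {F ⟨$⟩ y} {F ⟨$⟩ p} Fy<Fp)) ]′ (below-endpoint F convex {x} {y} {p} x<y y<p)

  -- F has already turned upwards between the two middle points, or is still going down there.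
  monotone-half : ∀ K (α : Fin (suc K ℕ.+ suc K) → ℝ) → Increasing α → Trichotomous (λ i → F ⟨$⟩ α i) →
    Σ[ ι ∈ (Fin (suc K) → Fin (suc K ℕ.+ suc K)) ]
      ((∀ i j → i Fin.< j → ι i Fin.< ι j) ×
       (Increasing (λ i → F ⟨$⟩ α (ι i)) ⊎ Decreasing (λ i → F ⟨$⟩ α (ι i))))
  monotone-half K α inc cmp = split (cmp p q)
    where
    left right : Fin (suc K) → Fin (suc K ℕ.+ suc K)
    left i = i ↑ˡ suc K
    right i = suc K ↑ʳ i
    p = left (Fin.fromℕ K)
    q = right zero
    left-mono : ∀ i j → i Fin.< j → left i Fin.< left j
    left-mono i j = subst₂ ℕ._<_ (sym (Fin.toℕ-↑ˡ i (suc K))) (sym (Fin.toℕ-↑ˡ j (suc K)))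
    right-mono : ∀ i j → i Fin.< j → right i Fin.< right j
    right-mono i j i<j = subst₂ ℕ._<_ (sym (Fin.toℕ-↑ʳ (suc K) i)) (sym (Fin.toℕ-↑ʳ (suc K) j))
      (ℕ.+-monoʳ-< (suc K) i<j)
    p<q : p Fin.< q
    p<q = subst₂ ℕ._<_ (sym (trans (Fin.toℕ-↑ˡ (Fin.fromℕ K) (suc K)) (Fin.toℕ-fromℕ K)))
      (sym (trans (Fin.toℕ-↑ʳ (suc K) zero) (ℕ.+-identityʳ (suc K)))) ℕ.≤-refl
    up : ¬ (F ⟨$⟩ α q < F ⟨$⟩ α p) → Increasing (λ i → F ⟨$⟩ α (right i))
    -- The first point of the right half is q itself, so p, q and the j-th point suffice.
    up h zero j 0<j = [ (λ h′ → contradiction h′ h) , (λ h′ → h′) ]′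
      (below-endpoint F convex {α p} {α q} {α (right j)} (inc p q p<q) (inc q (right j) (right-mono zero j 0<j)))
    up h (suc i) j i<j = increasing-right {α p} {α q} {α (right (suc i))} {α (right j)}
      (inc p q p<q) (inc q (right (suc i)) (right-mono zero (suc i) (ℕ.s≤s ℕ.z≤n)))
      (inc (right (suc i)) (right j) (right-mono (suc i) j i<j)) h
    down : ¬ (F ⟨$⟩ α p < F ⟨$⟩ α q) → Decreasing (λ i → F ⟨$⟩ α (left i))
    down h i j i<j with j Fin.≟ Fin.fromℕ K
    -- The last point of the left half is p itself.
    ... | yes refl = [ (λ h′ → h′) , (λ h′ → contradiction h′ h) ]′
      (below-endpoint F convex {α (left i)} {α p} {α q} (inc (left i) p (left-mono i j i<j)) (inc p q p<q))
    ... | no j≢K = decreasing-left {α (left i)} {α (left j)} {α p} {α q}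
      (inc (left i) (left j) (left-mono i j i<j))
      (inc (left j) p (left-mono j (Fin.fromℕ K) (Fin.≤∧≢⇒< (Fin.≤fromℕ j) j≢K)))
      (inc p q p<q) h
    split : F ⟨$⟩ α p < F ⟨$⟩ α q ⊎ F ⟨$⟩ α p ≈ F ⟨$⟩ α q ⊎ F ⟨$⟩ α q < F ⟨$⟩ α p →
      Σ[ ι ∈ (Fin (suc K) → Fin (suc K ℕ.+ suc K)) ]
        ((∀ i j → i Fin.< j → ι i Fin.< ι j) ×
         (Increasing (λ i → F ⟨$⟩ α (ι i)) ⊎ Decreasing (λ i → F ⟨$⟩ α (ι i))))
    split (inj₁ lt)        = right , right-mono , inj₁ (up (<-asym {F ⟨$⟩ α p} {F ⟨$⟩ α q} lt))
    split (inj₂ (inj₁ eq)) = right , right-mono , inj₁ (up (≈⇒≮ {F ⟨$⟩ α q} {F ⟨$⟩ α p} (≈-sym {F ⟨$⟩ α p} {F ⟨$⟩ α q} eq)))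
    split (inj₂ (inj₂ gt)) = left , left-mono , inj₂ (down (<-asym {F ⟨$⟩ α q} {F ⟨$⟩ α p} gt))

  -- The comparisons behind the sorting and behind the choice of a half are available only under a
  -- double negation. The 2K + 2 smallest points are kept, so that each half has K + 1 points and
  -- thus K steps.
  ¬¬-monotone-piece : ∀ {k} (a : Fin k → ℝ) → Injective _≡_ _≈_ a → ∀ K → suc K ℕ.+ suc K ℕ.≤ k →
    ¬ ¬ (Σ[ ι ∈ (Fin (suc K) → Fin k) ] (Increasing (a ∘ ι) ×
      (Increasing (λ i → F ⟨$⟩ a (ι i)) ⊎ Decreasing (λ i → F ⟨$⟩ a (ι i)))))
  ¬¬-monotone-piece {k} a a-inj K 2K+2≤k ¬piece =
    ¬¬-trichotomous a λ cmp → ¬¬-trichotomous (λ i → F ⟨$⟩ a i) λ cmpF →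
      let σ , σ-mono = sorting a cmp a-inj
          σ′ = λ i → σ (inject≤ i 2K+2≤k)
          inc : Increasing (a ∘ σ′)
          inc i j i<j = σ-mono (inject≤ i 2K+2≤k) (inject≤ j 2K+2≤k)
            (subst₂ ℕ._<_ (sym (Fin.toℕ-inject≤ i 2K+2≤k)) (sym (Fin.toℕ-inject≤ j 2K+2≤k)) i<j)
          ι , ι-mono , mono = monotone-half K (a ∘ σ′) inc (λ i j → cmpF (σ′ i) (σ′ j))
      in ¬piece (σ′ ∘ ι , (λ i j i<j → inc (ι i) (ι j) (ι-mono i j i<j)) , mono)

  module _ {K l p m n}
    (α : Fin (suc K) → ℝ) (α-inc : Increasing α)
    (F-mono : Increasing (λ i → F ⟨$⟩ α i) ⊎ Decreasing (λ i → F ⟨$⟩ α i))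
    (β : Fin l → ℝ) (β-inj : Injective _≡_ _≈_ β)
    (γ : Fin p → ℝ) (γ-inj : Injective _≡_ _≈_ γ)
    (s : Fin m → ℝ) (s-cmp : Trichotomous s)
    (t : Fin n → ℝ) (t-cmp : Trichotomous t)
    (α+β : ∀ i j → ∃[ x ] α i + β j ≈ s x)
    (Fα+γ : ∀ i q → ∃[ x ] (F ⟨$⟩ α i) + γ q ≈ t x) where

    -- Translation by δ and passage to ranks both keep strict order, so along a fixed translate the
    -- labels increase as `gap-count` demands.
    label-mono : ∀ {k o} (φ : Fin k → ℝ) (δ : ℝ) (r : Fin o → ℝ) (cmp : Trichotomous r)
      (φ+δ : ∀ i → ∃[ x ] φ i + δ ≈ r x) → ∀ {i j} → φ i < φ j →
      rank r cmp (proj₁ (φ+δ i)) Fin.< rank r cmp (proj₁ (φ+δ j))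
    label-mono φ δ r cmp φ+δ {i} {j} lt = rank-mono r cmp {proj₁ (φ+δ i)} {proj₁ (φ+δ j)}
      (<-respʳ-≈ {r (proj₁ (φ+δ i))} {φ j + δ} {r (proj₁ (φ+δ j))} (proj₂ (φ+δ j))
        (<-respˡ-≈ {φ i + δ} {r (proj₁ (φ+δ i))} {φ j + δ} (proj₂ (φ+δ i)) (+-monoˡ-< {φ i} {φ j} δ lt)))

    -- A difference vector of consecutive points of the graph determines the first of them.
    step-determined : ∀ i i′ j j′ q q′ →
      α (inject₁ i) + β j ≈ α (inject₁ i′) + β j′ → α (suc i) + β j ≈ α (suc i′) + β j′ →
      (F ⟨$⟩ α (inject₁ i)) + γ q ≈ (F ⟨$⟩ α (inject₁ i′)) + γ q′ →
      (F ⟨$⟩ α (suc i)) + γ q ≈ (F ⟨$⟩ α (suc i′)) + γ q′ →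
      ¬ (i Fin.< i′)
    step-determined i i′ j j′ q q′ e₁ e₂ e₃ e₄ i<i′ =
      ≈⇒≮ {(F ⟨$⟩ x′) + (F ⟨$⟩ y)} {(F ⟨$⟩ x) + (F ⟨$⟩ y′)}
        (≈-sym {(F ⟨$⟩ x) + (F ⟨$⟩ y′)} {(F ⟨$⟩ x′) + (F ⟨$⟩ y)}
          (translates {F ⟨$⟩ x} {F ⟨$⟩ y} {F ⟨$⟩ x′} {F ⟨$⟩ y′} {γ q} {γ q′} e₃ e₄))
        (increasing-increments F convex {x} {y} {x′} {y′}
          (α-inc (inject₁ i) (inject₁ i′) (subst₂ ℕ._<_ (sym (Fin.toℕ-inject₁ i)) (sym (Fin.toℕ-inject₁ i′)) i<i′))
          (α-inc (inject₁ i′) (suc i′) (subst (ℕ._< suc (toℕ i′)) (sym (Fin.toℕ-inject₁ i′)) ℕ.≤-refl))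
          (translates {x} {y} {x′} {y′} {β j} {β j′} e₁ e₂))
      where
      x = α (inject₁ i)
      y = α (suc i)
      x′ = α (inject₁ i′)
      y′ = α (suc i′)

    sumset-bound : K ℕ.* K ℕ.* K ℕ.* (l ℕ.* p) ℕ.≤ 32 ℕ.* (m ℕ.* m ℕ.* (n ℕ.* n))
    sumset-bound = [ (λ F-inc → count v (λ i q → v-mono i {q} (F-inc (inject₁ i) (suc i) (next i)))
                       (λ {i} {i′} {q} {q′} → v-≈ {i} {i′} {q} {q′}))
                   -- For decreasing F the ranks in T are reversed, which restores increasing labels
                   -- and keeps them faithful.
                   , (λ F-dec → count (λ i q → opposite (v i q))
                       (λ i q → opposite-anti (label-mono (λ i → F ⟨$⟩ α i) (γ q) t t-cmp (λ i → Fα+γ i q) {suc i} {inject₁ i}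
                         (F-dec (inject₁ i) (suc i) (next i))))
                       (λ {i} {i′} {q} {q′} eq → v-≈ {i} {i′} {q} {q′} (opposite-injective eq))) ]′ F-mono
      where
      u : Fin (suc K) → Fin l → Fin m
      u i j = rank s s-cmp (proj₁ (α+β i j))
      v : Fin (suc K) → Fin p → Fin n
      v i q = rank t t-cmp (proj₁ (Fα+γ i q))
      next : ∀ (i : Fin K) → inject₁ i Fin.< suc i
      next i = subst (ℕ._< suc (toℕ i)) (sym (Fin.toℕ-inject₁ i)) ℕ.≤-refl
      v-mono : ∀ i {q} → F ⟨$⟩ α (inject₁ i) < F ⟨$⟩ α (suc i) → v (inject₁ i) q Fin.< v (suc i) q
      v-mono i {q} = label-mono (λ i → F ⟨$⟩ α i) (γ q) t t-cmp (λ i → Fα+γ i q) {inject₁ i} {suc i}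
      u-≈ : ∀ {i i′ j j′} → u i j ≡ u i′ j′ → α i + β j ≈ α i′ + β j′
      u-≈ {i} {i′} {j} {j′} eq = ≈-trans {α i + β j} {s (proj₁ (α+β i j))} {α i′ + β j′} (proj₂ (α+β i j))
        (≈-trans {s (proj₁ (α+β i j))} {s (proj₁ (α+β i′ j′))} {α i′ + β j′}
          (rank-≈ s s-cmp {proj₁ (α+β i j)} {proj₁ (α+β i′ j′)} eq)
          (≈-sym {α i′ + β j′} {s (proj₁ (α+β i′ j′))} (proj₂ (α+β i′ j′))))
      v-≈ : ∀ {i i′ q q′} → v i q ≡ v i′ q′ → (F ⟨$⟩ α i) + γ q ≈ (F ⟨$⟩ α i′) + γ q′
      v-≈ {i} {i′} {q} {q′} eq = ≈-trans {(F ⟨$⟩ α i) + γ q} {t (proj₁ (Fα+γ i q))} {(F ⟨$⟩ α i′) + γ q′} (proj₂ (Fα+γ i q))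
        (≈-trans {t (proj₁ (Fα+γ i q))} {t (proj₁ (Fα+γ i′ q′))} {(F ⟨$⟩ α i′) + γ q′}
          (rank-≈ t t-cmp {proj₁ (Fα+γ i q)} {proj₁ (Fα+γ i′ q′)} eq)
          (≈-sym {(F ⟨$⟩ α i′) + γ q′} {t (proj₁ (Fα+γ i′ q′))} (proj₂ (Fα+γ i′ q′))))
      count : (w : Fin (suc K) → Fin p → Fin n) → (∀ i q → w (inject₁ i) q Fin.< w (suc i) q) →
        (∀ {i i′ q q′} → w i q ≡ w i′ q′ → (F ⟨$⟩ α i) + γ q ≈ (F ⟨$⟩ α i′) + γ q′) →
        K ℕ.* K ℕ.* K ℕ.* (l ℕ.* p) ℕ.≤ 32 ℕ.* (m ℕ.* m ℕ.* (n ℕ.* n))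
      count w w-mono w-≈ = gap-count K l p m n u w
        (λ i j → label-mono α (β j) s s-cmp (λ i → α+β i j) {inject₁ i} {suc i} (α-inc (inject₁ i) (suc i) (next i))) w-mono determined
        where
        determined : ∀ i i′ j j′ q q′ →
          u (inject₁ i) j ≡ u (inject₁ i′) j′ → u (suc i) j ≡ u (suc i′) j′ →
          w (inject₁ i) q ≡ w (inject₁ i′) q′ → w (suc i) q ≡ w (suc i′) q′ →
          i ≡ i′ × j ≡ j′ × q ≡ q′
        determined i i′ j j′ q q′ e₁ e₂ e₃ e₄ = compare (Fin.<-cmp i i′)
          where
          s₁ : α (inject₁ i) + β j ≈ α (inject₁ i′) + β j′
          s₁ = u-≈ {inject₁ i} {inject₁ i′} {j} {j′} e₁
          s₂ : α (suc i) + β j ≈ α (suc i′) + β j′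
          s₂ = u-≈ {suc i} {suc i′} {j} {j′} e₂
          t₁ : (F ⟨$⟩ α (inject₁ i)) + γ q ≈ (F ⟨$⟩ α (inject₁ i′)) + γ q′
          t₁ = w-≈ {inject₁ i} {inject₁ i′} {q} {q′} e₃
          t₂ : (F ⟨$⟩ α (suc i)) + γ q ≈ (F ⟨$⟩ α (suc i′)) + γ q′
          t₂ = w-≈ {suc i} {suc i′} {q} {q′} e₄
          compare : Tri (i Fin.< i′) (i ≡ i′) (i′ Fin.< i) → i ≡ i′ × j ≡ j′ × q ≡ q′
          compare (tri< i<i′ _ _) = contradiction i<i′ (step-determined i i′ j j′ q q′ s₁ s₂ t₁ t₂)
          compare (tri> _ _ i′<i) = contradiction i′<i (step-determined i′ i j′ j q′ q
            (≈-sym {α (inject₁ i) + β j} {α (inject₁ i′) + β j′} s₁)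
            (≈-sym {α (suc i) + β j} {α (suc i′) + β j′} s₂)
            (≈-sym {(F ⟨$⟩ α (inject₁ i)) + γ q} {(F ⟨$⟩ α (inject₁ i′)) + γ q′} t₁)
            (≈-sym {(F ⟨$⟩ α (suc i)) + γ q} {(F ⟨$⟩ α (suc i′)) + γ q′} t₂))
          -- Once the steps agree, their common end point cancels from the sums, and injectivity of
          -- `β` and `γ` gives back the translates.
          compare (tri≈ _ i≡i′ _) = i≡i′ ,
            β-inj {j} {j′} (+-cancelˡ-≈ {α (suc i)} {α (suc i′)} {β j} {β j′} α≈ s₂) ,
            γ-inj {q} {q′} (+-cancelˡ-≈ {F ⟨$⟩ α (suc i)} {F ⟨$⟩ α (suc i′)} {γ q} {γ q′}
              (Func.cong F {α (suc i)} {α (suc i′)} α≈) t₂)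
            where
            α≈ : α (suc i) ≈ α (suc i′)
            α≈ = subst (λ x → α (suc i) ≈ α (suc x)) i≡i′ (≈-refl {α (suc i)})

-- Sumsets

-- At most one point is lost when k points are cut into two halves of size K + 1.
halves : ∀ k → k ℕ.≤ 1 ⊎ ∃[ K ] (suc K ℕ.+ suc K ℕ.≤ k × k ℕ.≤ suc (suc K ℕ.+ suc K))
halves 0 = inj₁ z≤n
halves 1 = inj₁ ℕ.≤-refl
halves (suc (suc k)) with halves k
... | inj₁ k≤1 = inj₂ (0 , s≤s (s≤s z≤n) , s≤s (s≤s k≤1))
... | inj₂ (K , lo , hi) = inj₂ (suc K ,
  ℕ.≤-trans (ℕ.≤-reflexive (cong suc (ℕ.+-suc (suc K) (suc K)))) (s≤s (s≤s lo)) ,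
  ℕ.≤-trans (s≤s (s≤s hi)) (ℕ.≤-reflexive (cong suc (sym (cong suc (ℕ.+-suc (suc K) (suc K)))))))

-- M ≥ 1 is asked for only in the presence of an element, since for k = 0 the sumsets are empty.
small-power-bound : ∀ {k M} → k ℕ.≤ 3 → (Fin k → 1 ℕ.≤ M) → k ^ 5 ℕ.≤ (32 ℕ.* M) ^ 4
small-power-bound {zero}  _   _   = z≤n
small-power-bound {suc k} {M} k≤3 1≤M = begin
  suc k ^ 5       ≤⟨ ℕ.^-monoˡ-≤ 5 k≤3 ⟩
  3 ^ 5           ≤⟨ toWitness {a? = 3 ^ 5 ℕ.≤? 32 ^ 4} _ ⟩
  32 ^ 4          ≤⟨ ℕ.^-monoˡ-≤ 4 (ℕ.*-monoʳ-≤ 32 (1≤M zero)) ⟩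
  (32 ℕ.* M) ^ 4  ∎
  where open ℕ.≤-Reasoning

-- For K ≥ 1 one has k ≤ 2K + 3 ≤ 5K, and 5⁵ · 32 = 100000 is below 32⁴ = 1048576, so the constant
-- 1/32 leaves room. For K = 0 the hypothesis on K says nothing, but then k ≤ 3.
power-bound : ∀ {k M} K → k ℕ.≤ suc (suc K ℕ.+ suc K) → (Fin k → 1 ℕ.≤ M) →
  K ^ 5 ℕ.≤ 32 ℕ.* M ^ 4 → k ^ 5 ℕ.≤ (32 ℕ.* M) ^ 4
power-bound zero k≤3 1≤M _ = small-power-bound k≤3 1≤M
power-bound {k} {M} K@(suc K′) k≤ _ h = begin
  k ^ 5                        ≤⟨ ℕ.^-monoˡ-≤ 5 k≤5K ⟩
  (5 ℕ.* K) ^ 5                ≡⟨ ^-distribʳ-* 5 5 K ⟩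
  5 ^ 5 ℕ.* K ^ 5              ≤⟨ ℕ.*-monoʳ-≤ (5 ^ 5) h ⟩
  5 ^ 5 ℕ.* (32 ℕ.* M ^ 4)     ≡⟨ ℕ.*-assoc (5 ^ 5) 32 (M ^ 4) ⟨
  5 ^ 5 ℕ.* 32 ℕ.* M ^ 4       ≤⟨ ℕ.*-monoˡ-≤ (M ^ 4) (toWitness {a? = 5 ^ 5 ℕ.* 32 ℕ.≤? 32 ^ 4} _) ⟩
  32 ^ 4 ℕ.* M ^ 4             ≡⟨ ^-distribʳ-* 4 32 M ⟨
  (32 ℕ.* M) ^ 4               ∎
  where
  open ℕ.≤-Reasoning
  open +-*-Solver
  k≤5K : k ℕ.≤ 5 ℕ.* K
  k≤5K = begin
    k                            ≤⟨ k≤ ⟩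
    suc (suc K ℕ.+ suc K)        ≤⟨ ℕ.m≤m+n _ (3 ℕ.* K′) ⟩
    suc (suc K ℕ.+ suc K) ℕ.+ 3 ℕ.* K′
      ≡⟨ solve 1 (λ K′ → (con 1 :+ ((con 2 :+ K′) :+ (con 2 :+ K′))) :+ con 3 :* K′ := con 5 :* (con 1 :+ K′)) refl K′ ⟩
    5 ℕ.* K                      ∎

fifth-power-bound : ∀ {K l p m n M} → K ℕ.≤ l → K ℕ.≤ p → m ℕ.≤ M → n ℕ.≤ M →
  K ℕ.* K ℕ.* K ℕ.* (l ℕ.* p) ℕ.≤ 32 ℕ.* (m ℕ.* m ℕ.* (n ℕ.* n)) → K ^ 5 ℕ.≤ 32 ℕ.* M ^ 4
fifth-power-bound {K} {l} {p} {m} {n} {M} K≤l K≤p m≤M n≤M h = begin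
  K ^ 5                            ≡⟨ solve 1 (λ K → K :^ 5 := K :* K :* K :* (K :* K)) refl K ⟩
  K ℕ.* K ℕ.* K ℕ.* (K ℕ.* K)      ≤⟨ ℕ.*-monoʳ-≤ (K ℕ.* K ℕ.* K) (ℕ.*-mono-≤ K≤l K≤p) ⟩
  K ℕ.* K ℕ.* K ℕ.* (l ℕ.* p)      ≤⟨ h ⟩
  32 ℕ.* (m ℕ.* m ℕ.* (n ℕ.* n))   ≤⟨ ℕ.*-monoʳ-≤ 32 (ℕ.*-mono-≤ (ℕ.*-mono-≤ m≤M m≤M) (ℕ.*-mono-≤ n≤M n≤M)) ⟩
  32 ℕ.* (M ℕ.* M ℕ.* (M ℕ.* M))   ≡⟨ cong (32 ℕ.*_) (solve 1 (λ M → M :* M :* (M :* M) := M :^ 4) refl M) ⟩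
  32 ℕ.* M ^ 4                     ∎
  where
  open ℕ.≤-Reasoning
  open +-*-Solver

-- Comparison with the real fourth root.

1/32 : ℚ
1/32 = + 1 ℚ./ 32

1/32*-≤ : ∀ j n M → j ℕ.≤ M ℕ.* (32 ℕ.* suc n) → 1/32 ℚ.* (+ j ℚ./ suc n) ℚ.≤ + M ℚ./ 1
1/32*-≤ j n M h = ℚ.toℚᵘ-cancel-≤ (begin
  ℚ.toℚᵘ (1/32 ℚ.* (+ j ℚ./ suc n))           ≃⟨ ℚ.toℚᵘ-homo-* 1/32 (+ j ℚ./ suc n) ⟩
  ℚ.toℚᵘ 1/32 ℚᵘ.* ℚ.toℚᵘ (+ j ℚ./ suc n)     ≃⟨ ℚᵘ.*-congˡ {ℚ.toℚᵘ 1/32} (ℚ.toℚᵘ-fromℚᵘ (ℚᵘ.mkℚᵘ (+ j) n)) ⟩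
  ℚᵘ.mkℚᵘ (+ 1) 31 ℚᵘ.* ℚᵘ.mkℚᵘ (+ j) n       ≤⟨ ℚᵘ.*≤* (subst₂ ℤ._≤_ lhs (ℤ.pos-* M (32 ℕ.* suc n)) (ℤ.+≤+ h)) ⟩
  ℚᵘ.mkℚᵘ (+ M) 0                             ≃⟨ ℚ.toℚᵘ-fromℚᵘ (ℚᵘ.mkℚᵘ (+ M) 0) ⟨
  ℚ.toℚᵘ (+ M ℚ./ 1)                          ∎)
  where
  open ℚᵘ.≤-Reasoning
  lhs : + j ≡ (+ 1 ℤ.* + j) ℤ.* + 1
  lhs = sym (trans (ℤ.*-identityʳ (+ 1 ℤ.* + j)) (ℤ.*-identityˡ (+ j)))

-- Since `≤` denies the reverse strict inequality, a single index of the supposed gap can be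
-- refuted: the approximations to the root are rounded down, so each of them is at most 32M.
1/32*root-≤ : ∀ N M → N ℕ.≤ (32 ℕ.* M) ^ 4 → fromℚ 1/32 * root 4 N ≤ fromℕ M
1/32*root-≤ N M N≤ (ε , 0<ε , n , h) = <⇒≱ 0<ε
  (shift-≤ (ℚ.≤-trans (h n ℕ.≤-refl) (1/32*-≤ j n M j≤)) (lemma (+ M ℚ./ 1) ε))
  where
  j = ⌊root⌋ 4 (N ℕ.* suc n ^ 4)
  j≤ : j ℕ.≤ M ℕ.* (32 ℕ.* suc n)
  j≤ = ℕ.≮⇒≥ λ lt → ℕ.<⇒≱ (ℕ.^-monoˡ-< 4 lt) (begin
    j ^ 4                                ≤⟨ ⌊root⌋-lower 4 (N ℕ.* suc n ^ 4) ⟩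
    N ℕ.* suc n ^ 4                      ≤⟨ ℕ.*-monoˡ-≤ (suc n ^ 4) N≤ ⟩
    (32 ℕ.* M) ^ 4 ℕ.* suc n ^ 4         ≡⟨ ^-distribʳ-* 4 (32 ℕ.* M) (suc n) ⟨
    (32 ℕ.* M ℕ.* suc n) ^ 4             ≡⟨ cong (_^ 4) (trans (cong (ℕ._* suc n) (ℕ.*-comm 32 M)) (ℕ.*-assoc M 32 (suc n))) ⟩
    (M ℕ.* (32 ℕ.* suc n)) ^ 4           ∎)
    where open ℕ.≤-Reasoning
  open ℚS
  lemma : ∀ p e → p ℚ.- (p ℚ.+ e) ≡ 0ℚ ℚ.- e
  lemma = solve 2 (λ p e → p :- (p :+ e) := con 0ℚ :- e) refl

-- Bounds for the sizes of the sumsets.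

member : ∀ {X k} (X-card : HasCardinality X k) i → X (proj₁ X-card i)
member (f , _ , f-enum) i = Equivalence.from (f-enum (f i)) (i , ≈-refl {f i})

index : ∀ {X k} (X-card : HasCardinality X k) x → X x → ∃[ i ] x ≈ proj₁ X-card i
index (f , _ , f-enum) x = Equivalence.to (f-enum x)

Fin⇒1≤ : ∀ {n} → Fin n → 1 ℕ.≤ n
Fin⇒1≤ i = ℕ.≤-trans (s≤s z≤n) (Fin.toℕ<n i)

module _ (F : Func ℝ-setoid ℝ-setoid) (convex : StrictlyConvex F) where

  A+B-FA+C-bound : ∀ (A B C : Pred ℝ 0ℓ) k →
    HasCardinality A k → HasCardinality B k → HasCardinality C k →
    ∀ m n → HasCardinality (A ⊕ B) m → HasCardinality (image F A ⊕ C) n →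
    k ^ 5 ℕ.≤ (32 ℕ.* (m ⊔ n)) ^ 4
  A+B-FA+C-bound A B C k A-card@(a , a-inj , _) B-card@(b , b-inj , _) C-card@(c , c-inj , _)
    m n S-card@(s , _ , _) T-card@(t , _ , _) = [ (λ k≤1 → small-power-bound (ℕ.m≤n⇒m≤n+o 2 k≤1) 1≤M) , large ]′ (halves k)
    where
    in-S : ∀ i j → ∃[ x ] a i + b j ≈ s x
    in-S i j = index S-card (a i + b j) (a i , b j , member A-card i , member B-card j , ≈-refl {a i + b j})
    in-T : ∀ i j → ∃[ x ] (F ⟨$⟩ a i) + c j ≈ t x
    in-T i j = index T-card ((F ⟨$⟩ a i) + c j)
      (F ⟨$⟩ a i , c j , (a i , member A-card i , ≈-refl {F ⟨$⟩ a i}) , member C-card j , ≈-refl {(F ⟨$⟩ a i) + c j})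
    1≤M : Fin k → 1 ℕ.≤ m ⊔ n
    1≤M i = ℕ.≤-trans (Fin⇒1≤ (proj₁ (in-S i i))) (ℕ.m≤m⊔n m n)
    large : ∃[ K ] (suc K ℕ.+ suc K ℕ.≤ k × k ℕ.≤ suc (suc K ℕ.+ suc K)) → k ^ 5 ℕ.≤ (32 ℕ.* (m ⊔ n)) ^ 4
    large (K , lo , hi) = decidable-stable (_ ℕ.≤? _) λ ¬bound →
      ¬¬-monotone-piece F convex a a-inj K lo λ (ι , inc , mono) →
      ¬¬-trichotomous s λ s-cmp → ¬¬-trichotomous t λ t-cmp → ¬bound
        (power-bound K hi 1≤M (fifth-power-bound K≤k K≤k (ℕ.m≤m⊔n m n) (ℕ.m≤n⊔m m n)
          -- Only A is thinned out; B and C enter whole, so l = p = k.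
          (sumset-bound F convex (a ∘ ι) inc mono b b-inj c c-inj s s-cmp t t-cmp
            (λ i → in-S (ι i)) (λ i → in-T (ι i)))))
      where
      K≤k : K ℕ.≤ k
      K≤k = ℕ.≤-trans (ℕ.≤-trans (ℕ.n≤1+n K) (ℕ.m≤m+n (suc K) (suc K))) lo

  -- F may take a value twice on A, so B = F(A) is replaced by the image of a piece on which F is injective.
  A+FA-bound : ∀ (A : Pred ℝ 0ℓ) k → HasCardinality A k →
    ∀ n → HasCardinality (A ⊕ image F A) n → k ^ 5 ℕ.≤ (32 ℕ.* n) ^ 4
  A+FA-bound A k A-card@(a , a-inj , _) n S-card@(s , _ , _) =
    [ (λ k≤1 → small-power-bound (ℕ.m≤n⇒m≤n+o 2 k≤1) 1≤n) , large ]′ (halves k)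
    where
    in-S : ∀ i j → ∃[ x ] a i + (F ⟨$⟩ a j) ≈ s x
    in-S i j = index S-card (a i + (F ⟨$⟩ a j))
      (a i , F ⟨$⟩ a j , member A-card i , (a j , member A-card j , ≈-refl {F ⟨$⟩ a j}) , ≈-refl {a i + (F ⟨$⟩ a j)})
    in-S′ : ∀ i j → ∃[ x ] (F ⟨$⟩ a i) + a j ≈ s x
    in-S′ i j = let x , eq = in-S j i in
      x , ≈-trans {(F ⟨$⟩ a i) + a j} {a j + (F ⟨$⟩ a i)} {s x} (+-comm-≈ (F ⟨$⟩ a i) (a j)) eq
    1≤n : Fin k → 1 ℕ.≤ n
    1≤n i = Fin⇒1≤ (proj₁ (in-S i i))
    large : ∃[ K ] (suc K ℕ.+ suc K ℕ.≤ k × k ℕ.≤ suc (suc K ℕ.+ suc K)) → k ^ 5 ℕ.≤ (32 ℕ.* n) ^ 4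
    large (K , lo , hi) = decidable-stable (_ ℕ.≤? _) λ ¬bound →
      ¬¬-monotone-piece F convex a a-inj K lo λ (ι , inc , mono) →
      ¬¬-trichotomous s λ s-cmp → ¬bound
        -- The piece of A itself serves as C. All sums of both kinds lie in A + F(A), so `s` labels
        -- them all, and l = p = K + 1.
        (power-bound K hi 1≤n (fifth-power-bound {m = n} {n} {n} (ℕ.n≤1+n K) (ℕ.n≤1+n K) ℕ.≤-refl ℕ.≤-refl
          (sumset-bound F convex (a ∘ ι) inc mono
            (λ i → F ⟨$⟩ a (ι i))
            ([ (λ F-inc → increasing⇒injective {f = λ i → F ⟨$⟩ a (ι i)} F-inc)
             , (λ F-dec → decreasing⇒injective {f = λ i → F ⟨$⟩ a (ι i)} F-dec) ]′ mono)
            (a ∘ ι) (increasing⇒injective {f = a ∘ ι} inc) s s-cmp s s-cmp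
            (λ i j → in-S (ι i) (ι j)) (λ i j → in-S′ (ι i) (ι j)))))

theorem4 : Σ[ c ∈ ℝ ] (0ℝ < c ×
    ((F : Func ℝ-setoid ℝ-setoid) → StrictlyConvex F →
    ((A B C : Pred ℝ 0ℓ) (k : ℕ) →
    HasCardinality A k → HasCardinality B k → HasCardinality C k →
    (m n : ℕ) → HasCardinality (A ⊕ B) m → HasCardinality (image F A ⊕ C) n →
    c * root 4 (k ^ 5) ≤ fromℕ (m ⊔ n))
    ×
    ((A : Pred ℝ 0ℓ) (k : ℕ) → HasCardinality A k →
    (n : ℕ) → HasCardinality (A ⊕ image F A) n →
    c * root 4 (k ^ 5) ≤ fromℕ n)))
theorem4 =
  fromℚ 1/32 ,
  eventually-0< (fromℚ 1/32) 1/32 (ℚ.positive⁻¹ 1/32) 0 (λ _ _ → ℚ.≤-refl) ,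
  λ F convex →
    (λ A B C k A-card B-card C-card m n S-card T-card →
      1/32*root-≤ (k ^ 5) (m ⊔ n) (A+B-FA+C-bound F convex A B C k A-card B-card C-card m n S-card T-card)) ,
    (λ A k A-card n S-card → 1/32*root-≤ (k ^ 5) n (A+FA-bound F convex A k A-card n S-card))
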